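{- Let $G$ and $H$ be connected graphs with $\kappa(G)\ge 2$. (i) If $\mathrm{gon}(G)=2$, $\frac{|V(H)|}{\lambda(H)}\le\frac12|V(G)|$, and $|V(H)|\le \frac12|V(G)|\lambda(H)+(\delta(G)-\lambda(H))$, then $\mathrm{sn}(G\square H)=\mathrm{gon}(G\square H)=2|V(H)|$. (ii) If $\lambda(H)=\mathrm{gon}(H)$, $\frac{2|V(H)|}{\lambda(H)}\ge |V(G)|$, and $\lambda(H)\le\delta(G)$, then $\mathrm{sn}(G\square H)=\mathrm{gon}(G\square H)=|V(G)|\lambda(H)$.
   Context: Graphs are finite, multiple edges allowed, no loops. $\kappa$ is vertex-connectivity, $\lambda$ edge-connectivity (edges with multiplicity), $\delta(G)$ minimum valence. $G\square H$ is the Cartesian product (vertex set $V(G)\times V(H)$; $(u_1,v_1),(u_2,v_2)$ joined by $e$ edges iff $u_1=u_2$ and $v_1,v_2$ joined by $e$ edges in $H$, or $v_1=v_2$ and $u_1,u_2$ joined by $e$ edges in $G$). Scramble number $\mathrm{sn}$: a scramble is a finite collection of nonempty vertex sets (eggs) each inducing a connected subgraph; its order is $\min(h,e)$ where $h$ is the minimum size of a vertex set meeting every egg and $e$ is the minimum of $|E(A,A^C)|$ over $A\subseteq V$ containing some egg whose complement contains some egg ($+\infty$ if none); $\mathrm{sn}$ is the maximum order. Gonality: a divisor is an integer combination of vertices; firing a vertex $w$ removes $\mathrm{val}(w)$ chips from $w$ and gives each other vertex one chip per edge to $w$; divisors are equivalent if related by firings; $D$ has positive rank if $D-(v)$ is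 equivalent to an effective divisor for every vertex $v$; $\mathrm{gon}$ is the minimum degree of a positive rank divisor. -}

module Defs where

open import Data.Nat as ℕ using (ℕ; zero; suc; _≤_; _+_; _*_)
open import Data.Integer as ℤ using (ℤ; +_)
open import Data.Bool using (Bool; true; false; if_then_else_)
open import Data.Fin using (Fin; zero; suc; remQuot; _≟_)
open import Data.Fin.Subset using (Subset; _∈_; _∉_; _⊆_; ∁; _∩_; ∣_∣; Nonempty; ⊤)
open import Data.Vec using (lookup)
open import Data.List using (List)
open import Data.List.Relation.Unary.All using (All)
open import Data.List.Relation.Unary.Any using (Any)
open import Data.Product using (Σ; ∃; ∃-syntax; _×_; _,_; proj₁; proj₂)
open import Relation.Nullary using (yes; no; ¬_)
open import Relation.Binary.PropositionalEquality using (_≡_; refl; sym; trans)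
open import Relation.Binary.Construct.Closure.Equivalence using (EqClosure)

sumℕ : ∀ {n} → (Fin n → ℕ) → ℕ
sumℕ {zero}  f = 0
sumℕ {suc n} f = f zero + sumℕ (λ i → f (suc i))

sumℤ : ∀ {n} → (Fin n → ℤ) → ℤ
sumℤ {zero}  f = + 0
sumℤ {suc n} f = f zero ℤ.+ sumℤ (λ i → f (suc i))

-- Finite multigraphs without loops, vertex set Fin size.
-- edges u v = number of edges joining u and v.

record Graph : Set where
  field
    size     : ℕ
    edges    : Fin size → Fin size → ℕ
    symmetric : ∀ u v → edges u v ≡ edges v u
    loopless  : ∀ v → edges v v ≡ 0
open Graph public

∣V∣ : Graph → ℕ
∣V∣ G = size G

val : (G : Graph) → Fin (size G) → ℕ
val G v = sumℕ (λ w → edges G v w)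

MinValence : Graph → ℕ → Set
MinValence G d = (∃[ v ] val G v ≡ d) × (∀ v → d ≤ val G v)

-- walks staying inside the vertex set S (the start vertex is assumed in S separately)
data WalkIn (G : Graph) (S : Subset (size G)) : Fin (size G) → Fin (size G) → Set where
  here : ∀ {u} → WalkIn G S u u
  step : ∀ {u w v} → 0 ℕ.< edges G u w → w ∈ S → WalkIn G S w v → WalkIn G S u v

InducesConnected : (G : Graph) → Subset (size G) → Set
InducesConnected G S = Nonempty S × (∀ u v → u ∈ S → v ∈ S → WalkIn G S u v)

Connected : Graph → Set
Connected G = InducesConnected G ⊤

VertexConnAtLeast : ℕ → Graph → Set
VertexConnAtLeast k G = (k ℕ.< size G) × (∀ (X : Subset (size G)) → ∣ X ∣ ℕ.< k → InducesConnected G (∁ X))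

cut : (G : Graph) → Subset (size G) → ℕ
cut G A = sumℕ (λ u → sumℕ (λ v →
  if lookup A u then (if lookup A v then 0 else edges G u v) else 0))

EdgeConn : Graph → ℕ → Set
EdgeConn G l =
  (∃[ A ] Nonempty A × Nonempty (∁ A) × cut G A ≡ l) ×
  (∀ A → Nonempty A → Nonempty (∁ A) → l ≤ cut G A)

-- Cartesian product G □ H, vertex (u,v) encoded by Data.Fin.combine u v

_==_ : ∀ {n} → Fin n → Fin n → Bool
i == j with i ≟ j
... | yes _ = true
... | no  _ = false

prodEdges : (G H : Graph) → (Fin (size G) × Fin (size H)) → (Fin (size G) × Fin (size H)) → ℕ
prodEdges G H (u₁ , v₁) (u₂ , v₂) =
  if u₁ == u₂ then edges H v₁ v₂ else (if v₁ == v₂ then edges G u₁ u₂ else 0)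

private
  ==-sym : ∀ {n} (i j : Fin n) → (i == j) ≡ (j == i)
  ==-sym i j with i ≟ j | j ≟ i
  ... | yes _ | yes _ = refl
  ... | no  _ | no  _ = refl
  ... | yes p | no ¬q = Relation.Nullary.contradiction (sym p) ¬q
    where import Relation.Nullary
  ... | no ¬p | yes q = Relation.Nullary.contradiction (sym q) ¬p
    where import Relation.Nullary

  ==-refl : ∀ {n} (i : Fin n) → (i == i) ≡ true
  ==-refl i with i ≟ i
  ... | yes _ = refl
  ... | no ¬p = Relation.Nullary.contradiction refl ¬p
    where import Relation.Nullary

  prod-sym : (G H : Graph) → ∀ x y → prodEdges G H x y ≡ prodEdges G H y x
  prod-sym G H (u₁ , v₁) (u₂ , v₂)
    rewrite ==-sym u₁ u₂ | ==-sym v₁ v₂ | symmetric G u₁ u₂ | symmetric H v₁ v₂ = refl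

  prod-loop : (G H : Graph) → ∀ x → prodEdges G H x x ≡ 0
  prod-loop G H (u , v) rewrite ==-refl u = loopless H v

_□_ : Graph → Graph → Graph
G □ H = record
  { size = size G * size H
  ; edges = λ i j → prodEdges G H (remQuot (size H) i) (remQuot (size H) j)
  ; symmetric = λ i j → prod-sym G H (remQuot (size H) i) (remQuot (size H) j)
  ; loopless = λ i → prod-loop G H (remQuot (size H) i)
  }

record Scramble (G : Graph) : Set where
  field
    eggs      : List (Subset (size G))
    eggs-conn : All (InducesConnected G) eggs
open Scramble public

HittingSet : {G : Graph} → Scramble G → Subset (size G) → Set
HittingSet S X = All (λ E → Nonempty (X ∩ E)) (eggs S)

EggCut : {G : Graph} → Scramble G → Subset (size G) → Set
EggCut S A = Any (λ E → E ⊆ A) (eggs S) × Any (λ E → E ⊆ ∁ A) (eggs S)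

-- ||S|| = min(h, e) ≥ k, i.e. h ≥ k and e ≥ k (e = +∞ when there is no egg-cut)
OrderAtLeast : {G : Graph} → Scramble G → ℕ → Set
OrderAtLeast {G} S k =
  (∀ X → HittingSet S X → k ≤ ∣ X ∣) × (∀ A → EggCut S A → k ≤ cut G A)

ScrambleNumber : Graph → ℕ → Set
ScrambleNumber G k =
  (∃[ S ] OrderAtLeast {G} S k) × (∀ (S : Scramble G) m → OrderAtLeast S m → m ≤ k)

Divisor : Graph → Set
Divisor G = Fin (size G) → ℤ

deg : {G : Graph} → Divisor G → ℤ
deg D = sumℤ D

Effective : {G : Graph} → Divisor G → Set
Effective D = ∀ v → + 0 ℤ.≤ D v

fire : (G : Graph) → Fin (size G) → Divisor G → Divisor G
fire G w D v = if v == w then D v ℤ.- + val G w else D v ℤ.+ + edges G v w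

FireStep : (G : Graph) → Divisor G → Divisor G → Set
FireStep G D D' = ∃[ w ] (∀ v → D' v ≡ fire G w D v)

Equiv : (G : Graph) → Divisor G → Divisor G → Set
Equiv G D D' = EqClosure (FireStep G) D D'

minusVertex : (G : Graph) → Divisor G → Fin (size G) → Divisor G
minusVertex G D v w = if w == v then D w ℤ.- + 1 else D w

PositiveRank : (G : Graph) → Divisor G → Set
PositiveRank G D = ∀ v → ∃[ E ] Effective {G} E × Equiv G (minusVertex G D v) E

Gonality : Graph → ℕ → Set
Gonality G k =
  (∃[ D ] PositiveRank G D × deg {G} D ≡ + k) ×
  (∀ D → PositiveRank G D → + k ℤ.≤ deg {G} D)

{-# OPTIONS --safe #-}
module Submission where

-- The lower bound comes from the scramble whose eggs are the copies G × {v} of G with one vertex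
-- removed; they are connected because κ(G) ≥ 2. A hitting set needs two vertices in each of the |V(H)|
-- copies. A set A separating two eggs cuts all columns {u} × H, each at a cost of at least λ(H), except
-- possibly those of the two removed vertices, and every column that stays uncut forces a copy of G in
-- which exactly one vertex lies on the other side of A, at a cost of at least δ(G).
--
-- The upper bound on the gonality is obtained by pulling a divisor back along a projection. The two
-- meet because sn ≤ gon: if an effective divisor of positive rank misses an egg, moving a chip onto
-- that egg one level set of the firing script at a time either passes through an egg-cut, whose size
-- is then at most the degree, or keeps hitting all the eggs that were hit before. Repeating this
-- yields an equivalent effective divisor whose support is a hitting set.

open import Defs
open import Algebra.Structures using (IsCommutativeMonoid)
open import Data.Bool using (Bool; true; false; if_then_else_; not; _∧_)
open import Data.Empty using (⊥; ⊥-elim)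
open import Data.Fin using (Fin; zero; suc; _≟_; _↑ˡ_; _↑ʳ_; combine; remQuot; fromℕ<)
import Data.Fin.Properties as Fin
open import Data.Fin.Subset using (Subset; _∈_; _∉_; _⊆_; ∁; _∩_; ∣_∣; ⁅_⁆; Nonempty)
import Data.Fin.Subset.Properties as Subset
open import Data.Integer as ℤ using (ℤ; +_; -[1+_]; 0ℤ; 1ℤ)
import Data.Integer.Properties as ℤ
open import Data.Integer.Tactic.RingSolver using (solve-∀)
open import Data.List as List using (List; []; _∷_)
open import Data.List.Membership.Propositional using (lose) renaming (_∈_ to _∈ₗ_)
open import Data.List.Relation.Unary.All as All using ([]; _∷_)
import Data.List.Relation.Unary.All.Properties as All
open import Data.List.Relation.Unary.Any using (here; there)
import Data.List.Relation.Unary.Any.Properties as Any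
open import Data.Nat as ℕ using (ℕ; zero; suc; _≤_; _<_; _+_; _*_; z≤n; s≤s)
import Data.Nat.Properties as ℕ
open import Data.Nat.Tactic.RingSolver using () renaming (solve-∀ to ℕ-solve-∀)
open import Data.Product using (∃-syntax; _×_; _,_; proj₁; proj₂)
open import Data.Sum using (_⊎_; inj₁; inj₂)
open import Data.Vec using ([]; _∷_; lookup; tabulate)
import Data.Vec.Properties as Vec
open import Function using (_∘_; id)
import Relation.Binary.Construct.Closure.Equivalence as EqClosure
open import Relation.Binary.Construct.Closure.ReflexiveTransitive using (ε; _◅_; _◅◅_)
open import Relation.Binary.Construct.Closure.Symmetric using (fwd; bwd)
open import Relation.Binary.PropositionalEquality
  using (_≡_; _≢_; refl; sym; trans; cong; cong₂; subst; subst₂; module ≡-Reasoning)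
open import Relation.Nullary using (¬_; Dec; yes; no; does; contradiction)
open import Relation.Nullary.Decidable using (_×-dec_; dec-true; decidable-stable)

-- Boolean equality of vertices.

true≢false : true ≢ false
true≢false ()

==-refl : ∀ {n} (i : Fin n) → (i == i) ≡ true
==-refl i with i ≟ i
... | yes _  = refl
... | no i≢i = contradiction refl i≢i

==-≢ : ∀ {n} {i j : Fin n} → i ≢ j → (i == j) ≡ false
==-≢ {i = i} {j} i≢j with i ≟ j
... | yes i≡j = contradiction i≡j i≢j
... | no _    = refl

==⇒≡ : ∀ {n} {i j : Fin n} → (i == j) ≡ true → i ≡ j
==⇒≡ {i = i} {j} eq with i ≟ j
... | yes i≡j = i≡j

==-false⇒≢ : ∀ {n} {i j : Fin n} → (i == j) ≡ false → i ≢ j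
==-false⇒≢ {i = i} eq refl = true≢false (trans (sym (==-refl i)) eq)

==-sym : ∀ {n} (i j : Fin n) → (i == j) ≡ (j == i)
==-sym i j with j ≟ i
... | yes refl = ==-refl i
... | no j≢i   = ==-≢ (j≢i ∘ sym)

==-suc : ∀ {n} (i j : Fin n) → (suc i == suc j) ≡ (i == j)
==-suc i j with i ≟ j
... | yes _ = refl
... | no  _ = refl

-- Finite sums in an ordered commutative monoid.

module FiniteSum
  {A : Set} {_∙_ : A → A → A} {e : A} (isCM : IsCommutativeMonoid _≡_ _∙_ e)
  {_≼_ : A → A → Set} (≼-refl : ∀ {x} → x ≼ x)
  (∙-mono : ∀ {a b c d} → a ≼ b → c ≼ d → (a ∙ c) ≼ (b ∙ d))
  (∑ : ∀ {n} → (Fin n → A) → A)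
  (∑-zero : (f : Fin 0 → A) → ∑ f ≡ e)
  (∑-suc : ∀ {n} (f : Fin (suc n) → A) → ∑ f ≡ f zero ∙ ∑ (f ∘ suc)) where

  open IsCommutativeMonoid isCM using (assoc; comm; identityˡ; identityʳ)
  open ≡-Reasoning

  ∑-cong : ∀ {n} {f g : Fin n → A} → (∀ i → f i ≡ g i) → ∑ f ≡ ∑ g
  ∑-cong {zero}  {f} {g} f≗g = trans (∑-zero f) (sym (∑-zero g))
  ∑-cong {suc n} {f} {g} f≗g = begin
    ∑ f                    ≡⟨ ∑-suc f ⟩
    f zero ∙ ∑ (f ∘ suc)   ≡⟨ cong₂ _∙_ (f≗g zero) (∑-cong (f≗g ∘ suc)) ⟩
    g zero ∙ ∑ (g ∘ suc)   ≡⟨ ∑-suc g ⟨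
    ∑ g                    ∎

  ∑-mono : ∀ {n} {f g : Fin n → A} → (∀ i → f i ≼ g i) → ∑ f ≼ ∑ g
  ∑-mono {zero}  {f} {g} f≼g = subst₂ _≼_ (sym (∑-zero f)) (sym (∑-zero g)) ≼-refl
  ∑-mono {suc n} {f} {g} f≼g =
    subst₂ _≼_ (sym (∑-suc f)) (sym (∑-suc g)) (∙-mono (f≼g zero) (∑-mono (f≼g ∘ suc)))

  ∑-ε : ∀ {n} → ∑ {n} (λ _ → e) ≡ e
  ∑-ε {zero}  = ∑-zero _
  ∑-ε {suc n} = trans (∑-suc _) (trans (identityˡ _) (∑-ε {n}))

  interchange : ∀ a b c d → (a ∙ b) ∙ (c ∙ d) ≡ (a ∙ c) ∙ (b ∙ d)
  interchange a b c d = begin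
    (a ∙ b) ∙ (c ∙ d)   ≡⟨ assoc a b (c ∙ d) ⟩
    a ∙ (b ∙ (c ∙ d))   ≡⟨ cong (a ∙_) (assoc b c d) ⟨
    a ∙ ((b ∙ c) ∙ d)   ≡⟨ cong (λ x → a ∙ (x ∙ d)) (comm b c) ⟩
    a ∙ ((c ∙ b) ∙ d)   ≡⟨ cong (a ∙_) (assoc c b d) ⟩
    a ∙ (c ∙ (b ∙ d))   ≡⟨ assoc a c (b ∙ d) ⟨
    (a ∙ c) ∙ (b ∙ d)   ∎

  ∑-∙ : ∀ {n} (f g : Fin n → A) → ∑ (λ i → f i ∙ g i) ≡ ∑ f ∙ ∑ g
  ∑-∙ {zero}  f g = begin
    ∑ (λ i → f i ∙ g i)   ≡⟨ ∑-zero _ ⟩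
    e                     ≡⟨ identityˡ e ⟨
    e ∙ e                 ≡⟨ cong₂ _∙_ (∑-zero f) (∑-zero g) ⟨
    ∑ f ∙ ∑ g             ∎
  ∑-∙ {suc n} f g = begin
    ∑ (λ i → f i ∙ g i)                                     ≡⟨ ∑-suc _ ⟩
    (f zero ∙ g zero) ∙ ∑ (λ i → f (suc i) ∙ g (suc i))     ≡⟨ cong (_ ∙_) (∑-∙ (f ∘ suc) (g ∘ suc)) ⟩
    (f zero ∙ g zero) ∙ (∑ (f ∘ suc) ∙ ∑ (g ∘ suc))         ≡⟨ interchange _ _ _ _ ⟩
    (f zero ∙ ∑ (f ∘ suc)) ∙ (g zero ∙ ∑ (g ∘ suc))         ≡⟨ cong₂ _∙_ (∑-suc f) (∑-suc g) ⟨
    ∑ f ∙ ∑ g                                               ∎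

  ∑-swap : ∀ {m n} (f : Fin m → Fin n → A) →
    ∑ (λ i → ∑ (λ j → f i j)) ≡ ∑ (λ j → ∑ (λ i → f i j))
  ∑-swap {zero}  {n} f = begin
    ∑ (λ i → ∑ (f i))                ≡⟨ ∑-zero _ ⟩
    e                                ≡⟨ ∑-ε {n} ⟨
    ∑ {n} (λ _ → e)                  ≡⟨ ∑-cong (λ j → ∑-zero (λ i → f i j)) ⟨
    ∑ (λ j → ∑ (λ i → f i j))        ∎
  ∑-swap {suc m} f = begin
    ∑ (λ i → ∑ (f i))                                     ≡⟨ ∑-suc _ ⟩
    ∑ (f zero) ∙ ∑ (λ i → ∑ (f (suc i)))                  ≡⟨ cong (∑ (f zero) ∙_) (∑-swap (f ∘ suc)) ⟩
    ∑ (f zero) ∙ ∑ (λ j → ∑ (λ i → f (suc i) j))          ≡⟨ ∑-∙ _ _ ⟨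
    ∑ (λ j → f zero j ∙ ∑ (λ i → f (suc i) j))            ≡⟨ ∑-cong (λ j → ∑-suc (λ i → f i j)) ⟨
    ∑ (λ j → ∑ (λ i → f i j))                             ∎

  ∑-++ : ∀ m {n} (f : Fin (m + n) → A) →
    ∑ f ≡ ∑ (λ i → f (i ↑ˡ n)) ∙ ∑ (λ j → f (m ↑ʳ j))
  ∑-++ zero    f = trans (sym (identityˡ _)) (cong (_∙ _) (sym (∑-zero _)))
  ∑-++ (suc m) {n} f = begin
    ∑ f                                                                       ≡⟨ ∑-suc f ⟩
    f zero ∙ ∑ (f ∘ suc)
      ≡⟨ cong (_ ∙_) (∑-++ m (f ∘ suc)) ⟩
    f zero ∙ (∑ (λ i → f (suc (i ↑ˡ n))) ∙ ∑ (λ j → f (suc (m ↑ʳ j))))        ≡⟨ assoc _ _ _ ⟨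
    (f zero ∙ ∑ (λ i → f (suc (i ↑ˡ n)))) ∙ ∑ (λ j → f (suc (m ↑ʳ j)))        ≡⟨ cong (_∙ _) (∑-suc _) ⟨
    ∑ (λ i → f (i ↑ˡ n)) ∙ ∑ (λ j → f (suc m ↑ʳ j))                           ∎

  ∑-combine : ∀ m n (f : Fin (m * n) → A) →
    ∑ f ≡ ∑ (λ (u : Fin m) → ∑ (λ (v : Fin n) → f (combine u v)))
  ∑-combine zero    n f = trans (∑-zero f) (sym (∑-zero _))
  ∑-combine (suc m) n f = begin
    ∑ f                                                              ≡⟨ ∑-++ n f ⟩
    ∑ (λ v → f (v ↑ˡ m * n)) ∙ ∑ (λ j → f (n ↑ʳ j))
      ≡⟨ cong (∑ (λ v → f (v ↑ˡ m * n)) ∙_) (∑-combine m n (λ j → f (n ↑ʳ j))) ⟩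
    ∑ (λ v → f (v ↑ˡ m * n)) ∙ ∑ (λ u → ∑ (λ v → f (n ↑ʳ combine u v)))  ≡⟨ ∑-suc _ ⟨
    ∑ (λ u → ∑ (λ v → f (combine u v)))                              ∎

  ∑-select : ∀ {n} (i : Fin n) (f : Fin n → A) → ∑ (λ j → if i == j then f j else e) ≡ f i
  ∑-select zero f = begin
    ∑ (λ j → if zero == j then f j else e)   ≡⟨ ∑-suc _ ⟩
    f zero ∙ ∑ (λ _ → e)                     ≡⟨ cong (_ ∙_) ∑-ε ⟩
    f zero ∙ e                               ≡⟨ identityʳ _ ⟩
    f zero                                   ∎
  ∑-select (suc i) f = begin
    ∑ (λ j → if suc i == j then f j else e)                 ≡⟨ ∑-suc _ ⟩
    e ∙ ∑ (λ j → if suc i == suc j then f (suc j) else e)   ≡⟨ identityˡ _ ⟩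
    ∑ (λ j → if suc i == suc j then f (suc j) else e)
      ≡⟨ ∑-cong (λ j → cong (if_then f (suc j) else e) (==-suc i j)) ⟩
    ∑ (λ j → if i == j then f (suc j) else e)               ≡⟨ ∑-select i (f ∘ suc) ⟩
    f (suc i)                                               ∎

  ∑-if : ∀ {n} b (f : Fin n → A) → ∑ (λ j → if b then f j else e) ≡ (if b then ∑ f else e)
  ∑-if true  f = refl
  ∑-if false f = ∑-ε

  term≼∑ : ∀ {n} (f : Fin n → A) → (∀ j → e ≼ f j) → ∀ i → f i ≼ ∑ f
  term≼∑ f e≼f i = subst (_≼ ∑ f) (∑-select i f) (∑-mono bound)
    where
    bound : ∀ j → (if i == j then f j else e) ≼ f j
    bound j with i == j
    ... | true  = ≼-refl
    ... | false = e≼f j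

-- `sumℕ` and `sumℤ` are separate recursions, so the module takes the summation operator and its two
-- defining equations as parameters and serves both.
module ℕ∑ = FiniteSum ℕ.+-0-isCommutativeMonoid {_≤_} ℕ.≤-refl ℕ.+-mono-≤
  sumℕ (λ _ → refl) (λ _ → refl)
module ℤ∑ = FiniteSum ℤ.+-0-isCommutativeMonoid {ℤ._≤_} ℤ.≤-refl ℤ.+-mono-≤
  sumℤ (λ _ → refl) (λ _ → refl)

-- Integer sums, the graph Laplacian and firing scripts.

pos-sum : ∀ {n} (f : Fin n → ℕ) → + sumℕ f ≡ sumℤ (λ i → + f i)
pos-sum {zero}  f = refl
pos-sum {suc n} f = cong (ℤ._+_ (+ f zero)) (pos-sum (f ∘ suc))

neg-sum : ∀ {n} (f : Fin n → ℤ) → sumℤ (λ i → ℤ.- f i) ≡ ℤ.- sumℤ f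
neg-sum {zero}  f = refl
neg-sum {suc n} f = trans (cong (ℤ._+_ (ℤ.- f zero)) (neg-sum (f ∘ suc)))
  (sym (ℤ.neg-distrib-+ (f zero) _))

sumℤ-const : ∀ n z → sumℤ {n} (λ _ → z) ≡ + n ℤ.* z
sumℤ-const zero    z = refl
sumℤ-const (suc n) z = trans (cong (ℤ._+_ z) (sumℤ-const n z)) (sym (ℤ.suc-* (+ n) z))

sumℕ-const : ∀ n k → sumℕ {n} (λ _ → k) ≡ n * k
sumℕ-const zero    k = refl
sumℕ-const (suc n) k = cong (ℕ._+_ k) (sumℕ-const n k)

-- The sign is chosen so that `D + Δ f` results from firing every vertex `w` exactly `f w` times:
-- `v` gains `f w` and loses `f v` along each edge to `w`.
laplacian : (G : Graph) → (Fin (size G) → ℤ) → Fin (size G) → ℤ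
laplacian G f v = sumℤ (λ w → + edges G v w ℤ.* (f w ℤ.- f v))

𝟙 : ∀ {n} → (Fin n → Bool) → Fin n → ℤ
𝟙 b x = if b x then 1ℤ else 0ℤ

module _ (G : Graph) where
  private
    V = Fin (size G)
    Δ = laplacian G

  laplacian-cong : {f g : V → ℤ} → (∀ v → f v ≡ g v) → ∀ v → Δ f v ≡ Δ g v
  laplacian-cong f≗g v = ℤ∑.∑-cong (λ w →
    cong₂ (λ a b → + edges G v w ℤ.* (a ℤ.- b)) (f≗g w) (f≗g v))

  laplacian-const : ∀ c v → Δ (λ _ → c) v ≡ 0ℤ
  laplacian-const c v = trans (ℤ∑.∑-cong (λ w → vanish (+ edges G v w) c)) (ℤ∑.∑-ε {size G})
    where
    vanish : ∀ a c → a ℤ.* (c ℤ.- c) ≡ 0ℤ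
    vanish = solve-∀

  laplacian-+ : (f g : V → ℤ) → ∀ v → Δ (λ x → f x ℤ.+ g x) v ≡ Δ f v ℤ.+ Δ g v
  laplacian-+ f g v = trans (ℤ∑.∑-cong (λ w → expand (+ edges G v w) (f w) (g w) (f v) (g v)))
    (ℤ∑.∑-∙ (λ w → + edges G v w ℤ.* (f w ℤ.- f v)) (λ w → + edges G v w ℤ.* (g w ℤ.- g v)))
    where
    expand : ∀ a p q r s → a ℤ.* ((p ℤ.+ q) ℤ.- (r ℤ.+ s)) ≡ a ℤ.* (p ℤ.- r) ℤ.+ a ℤ.* (q ℤ.- s)
    expand = solve-∀

  laplacian-neg : (f : V → ℤ) → ∀ v → Δ (λ x → ℤ.- f x) v ≡ ℤ.- Δ f v
  laplacian-neg f v = trans (ℤ∑.∑-cong (λ w → expand (+ edges G v w) (f w) (f v)))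
                            (neg-sum (λ w → + edges G v w ℤ.* (f w ℤ.- f v)))
    where
    expand : ∀ a p q → a ℤ.* (ℤ.- p ℤ.- ℤ.- q) ≡ ℤ.- (a ℤ.* (p ℤ.- q))
    expand = solve-∀

  -- Exchanging the two sums and using the symmetry of `edges` shows that the total equals its own
  -- negative.
  deg-laplacian : (f : V → ℤ) → sumℤ (Δ f) ≡ 0ℤ
  deg-laplacian f = self-negative (begin
    sumℤ (λ v → sumℤ (λ w → + edges G v w ℤ.* (f w ℤ.- f v)))
      ≡⟨ ℤ∑.∑-swap (λ v w → + edges G v w ℤ.* (f w ℤ.- f v)) ⟩
    sumℤ (λ w → sumℤ (λ v → + edges G v w ℤ.* (f w ℤ.- f v)))
      ≡⟨ ℤ∑.∑-cong (λ w → ℤ∑.∑-cong (λ v → flip v w)) ⟩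
    sumℤ (λ w → sumℤ (λ v → ℤ.- (+ edges G w v ℤ.* (f v ℤ.- f w))))
      ≡⟨ ℤ∑.∑-cong (λ w → neg-sum (λ v → + edges G w v ℤ.* (f v ℤ.- f w))) ⟩
    sumℤ (λ w → ℤ.- Δ f w)                                                ≡⟨ neg-sum (Δ f) ⟩
    ℤ.- sumℤ (Δ f)                                                        ∎)
    where
    open ≡-Reasoning
    negate : ∀ a p q → a ℤ.* (p ℤ.- q) ≡ ℤ.- (a ℤ.* (q ℤ.- p))
    negate = solve-∀
    flip : ∀ v w → + edges G v w ℤ.* (f w ℤ.- f v) ≡ ℤ.- (+ edges G w v ℤ.* (f v ℤ.- f w))
    flip v w rewrite symmetric G v w = negate (+ edges G w v) (f w) (f v)
    self-negative : ∀ {z} → z ≡ ℤ.- z → z ≡ 0ℤ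
    self-negative {+ zero} _ = refl

  outdegree : (V → Bool) → V → ℕ
  outdegree b v = sumℕ (λ w → if b w then 0 else edges G v w)

  -- When a whole set fires, chips along inner edges cancel, so a member pays only for its edges
  -- leaving the set.
  laplacian-𝟙-inside : (b : V → Bool) → ∀ v → b v ≡ true → Δ (𝟙 b) v ≡ ℤ.- + outdegree b v
  laplacian-𝟙-inside b v bv = begin
    Δ (𝟙 b) v                                                ≡⟨ ℤ∑.∑-cong term ⟩
    sumℤ (λ w → ℤ.- + (if b w then 0 else edges G v w))
      ≡⟨ neg-sum (λ w → + (if b w then 0 else edges G v w)) ⟩
    ℤ.- sumℤ (λ w → + (if b w then 0 else edges G v w))
      ≡⟨ cong ℤ.-_ (pos-sum (λ w → if b w then 0 else edges G v w)) ⟨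
    ℤ.- + outdegree b v                                      ∎
    where
    open ≡-Reasoning
    times-1 : ∀ a → a ℤ.* (0ℤ ℤ.- 1ℤ) ≡ ℤ.- a
    times-1 = solve-∀
    term : ∀ w → + edges G v w ℤ.* (𝟙 b w ℤ.- 𝟙 b v) ≡ ℤ.- + (if b w then 0 else edges G v w)
    term w rewrite bv with b w
    ... | true  = ℤ.*-zeroʳ (+ edges G v w)
    ... | false = times-1 (+ edges G v w)

  laplacian-𝟙-outside : (b : V → Bool) → ∀ v → b v ≡ false →
    Δ (𝟙 b) v ≡ + sumℕ (λ w → if b w then edges G v w else 0)
  laplacian-𝟙-outside b v bv = trans (ℤ∑.∑-cong term) (sym (pos-sum (λ w → if b w then edges G v w else 0)))
    where
    term : ∀ w → + edges G v w ℤ.* (𝟙 b w ℤ.- 𝟙 b v) ≡ + (if b w then edges G v w else 0)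
    term w rewrite bv with b w
    ... | true  = ℤ.*-identityʳ (+ edges G v w)
    ... | false = ℤ.*-zeroʳ (+ edges G v w)

  -- Looplessness makes the outdegree of the set consisting of `w` equal to the valence of `w`; at
  -- any other vertex the sum selects the edges to `w`.
  fire-laplacian : ∀ w (D : Divisor G) v → fire G w D v ≡ D v ℤ.+ Δ (𝟙 (w ==_)) v
  fire-laplacian w D v = by-cases (w == v) refl
    where
    open ≡-Reasoning
    no-loop : ∀ x → (if w == x then 0 else edges G w x) ≡ edges G w x
    no-loop x with w == x in w=x
    ... | true rewrite sym (==⇒≡ w=x) = sym (loopless G w)
    ... | false = refl

    at-w : fire G w D w ≡ D w ℤ.+ Δ (𝟙 (w ==_)) w
    at-w = begin
      fire G w D w
        ≡⟨ cong (if_then D w ℤ.- + val G w else (D w ℤ.+ + edges G w w)) (==-refl w) ⟩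
      D w ℤ.- + val G w                         ≡⟨ cong (λ k → D w ℤ.- + k) (ℕ∑.∑-cong no-loop) ⟨
      D w ℤ.- + outdegree (w ==_) w
        ≡⟨ cong (ℤ._+_ (D w)) (laplacian-𝟙-inside (w ==_) w (==-refl w)) ⟨
      D w ℤ.+ Δ (𝟙 (w ==_)) w                   ∎

    by-cases : ∀ b → (w == v) ≡ b → fire G w D v ≡ D v ℤ.+ Δ (𝟙 (w ==_)) v
    by-cases true  w=v = subst (λ x → fire G w D x ≡ D x ℤ.+ Δ (𝟙 (w ==_)) x) (==⇒≡ w=v) at-w
    by-cases false w≠v = begin
      fire G w D v
        ≡⟨ cong (if_then D v ℤ.- + val G w else (D v ℤ.+ + edges G v w)) (trans (==-sym v w) w≠v) ⟩
      D v ℤ.+ + edges G v w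
        ≡⟨ cong (λ k → D v ℤ.+ + k) (ℕ∑.∑-select w (edges G v)) ⟨
      D v ℤ.+ + sumℕ (λ x → if w == x then edges G v x else 0)
        ≡⟨ cong (ℤ._+_ (D v)) (laplacian-𝟙-outside (w ==_) v w≠v) ⟨
      D v ℤ.+ Δ (𝟙 (w ==_)) v                                     ∎

  -- Equivalence with its firing script kept visible, because the script is later cut into level
  -- sets.
  record Reaches (f : V → ℤ) (D D' : Divisor G) : Set where
    constructor reaches
    field at : ∀ v → D' v ≡ D v ℤ.+ Δ f v
  open Reaches public

  -- Constant scripts move no chips. The value `c` is left free because a script is later shifted by
  -- 1 to become an indicator function.
  reaches-≗ : ∀ c {D D'} → (∀ v → D v ≡ D' v) → Reaches (λ _ → c) D D'
  reaches-≗ c {D} {D'} D≗D' .at v = sym (begin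
    D v ℤ.+ Δ (λ _ → c) v     ≡⟨ cong (ℤ._+_ (D v)) (laplacian-const c v) ⟩
    D v ℤ.+ 0ℤ                ≡⟨ ℤ.+-identityʳ (D v) ⟩
    D v                       ≡⟨ D≗D' v ⟩
    D' v                      ∎)
    where open ≡-Reasoning

  reaches-cong : ∀ {f g D D'} → (∀ v → f v ≡ g v) → Reaches f D D' → Reaches g D D'
  reaches-cong {D = D} f≗g r .at v = trans (r .at v) (cong (ℤ._+_ (D v)) (laplacian-cong f≗g v))

  reaches-neg : ∀ {f D D'} → Reaches f D D' → Reaches (λ v → ℤ.- f v) D' D
  reaches-neg {f} {D} {D'} r .at v = begin
    D v                                        ≡⟨ cancel (D v) (Δ f v) ⟩
    (D v ℤ.+ Δ f v) ℤ.+ ℤ.- Δ f v              ≡⟨ cong₂ ℤ._+_ (r .at v) (laplacian-neg f v) ⟨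
    D' v ℤ.+ Δ (λ x → ℤ.- f x) v               ∎
    where
    open ≡-Reasoning
    cancel : ∀ a b → a ≡ (a ℤ.+ b) ℤ.+ ℤ.- b
    cancel = solve-∀

  reaches-+ : ∀ {f g D D' D''} → Reaches f D D' → Reaches g D' D'' → Reaches (λ v → f v ℤ.+ g v) D D''
  reaches-+ {f} {g} {D} {D'} {D''} r s .at v = begin
    D'' v                                      ≡⟨ s .at v ⟩
    D' v ℤ.+ Δ g v                             ≡⟨ cong (ℤ._+ Δ g v) (r .at v) ⟩
    (D v ℤ.+ Δ f v) ℤ.+ Δ g v                  ≡⟨ ℤ.+-assoc (D v) (Δ f v) (Δ g v) ⟩
    D v ℤ.+ (Δ f v ℤ.+ Δ g v)                  ≡⟨ cong (ℤ._+_ (D v)) (laplacian-+ f g v) ⟨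
    D v ℤ.+ Δ (λ x → f x ℤ.+ g x) v            ∎
    where open ≡-Reasoning

  reaches-deg : ∀ {f D D'} → Reaches f D D' → deg {G} D' ≡ deg {G} D
  reaches-deg {f} {D} {D'} r = begin
    sumℤ D'                         ≡⟨ ℤ∑.∑-cong (r .at) ⟩
    sumℤ (λ v → D v ℤ.+ Δ f v)      ≡⟨ ℤ∑.∑-∙ D (Δ f) ⟩
    sumℤ D ℤ.+ sumℤ (Δ f)           ≡⟨ cong (ℤ._+_ (sumℤ D)) (deg-laplacian f) ⟩
    sumℤ D ℤ.+ 0ℤ                   ≡⟨ ℤ.+-identityʳ _ ⟩
    sumℤ D                          ∎
    where open ≡-Reasoning

  reaches-fire : ∀ {w D D'} → (∀ v → D' v ≡ fire G w D v) → Reaches (𝟙 (w ==_)) D D'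
  reaches-fire {w} {D} fired .at v = trans (fired v) (fire-laplacian w D v)

  -- Every link of the chain contributes the indicator of the fired vertex, negated when the link is
  -- traversed backwards.
  equiv⇒reaches : ∀ {D D'} → Equiv G D D' → ∃[ f ] Reaches f D D'
  equiv⇒reaches ε = _ , reaches-≗ 0ℤ (λ _ → refl)
  equiv⇒reaches (fwd (_ , fired) ◅ rest) with equiv⇒reaches rest
  ... | _ , r = _ , reaches-+ (reaches-fire fired) r
  equiv⇒reaches (bwd (_ , fired) ◅ rest) with equiv⇒reaches rest
  ... | _ , r = _ , reaches-+ (reaches-neg (reaches-fire fired)) r

  -- Quantified over all pairs of divisors: realizing a sum of two scripts passes through an
  -- intermediate divisor determined by the first script.
  record Realizable (f : V → ℤ) : Set where
    constructor realizes
    field realize : ∀ {D D'} → Reaches f D D' → Equiv G D D'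
  open Realizable public

  realizable-cong : ∀ {f g} → (∀ v → f v ≡ g v) → Realizable f → Realizable g
  realizable-cong f≗g real .realize r = real .realize (reaches-cong (sym ∘ f≗g) r)

  -- Divisors are functions, so pointwise equal ones are joined by firing some vertex and undoing it.
  realizable-0 : V → Realizable (λ _ → 0ℤ)
  realizable-0 w .realize {D} {D'} r = fwd (w , λ _ → refl) ◅ bwd (w , same) ◅ ε
    where
    D≗D' : ∀ v → D v ≡ D' v
    D≗D' v = sym (trans (r .at v) (trans (cong (ℤ._+_ (D v)) (laplacian-const 0ℤ v)) (ℤ.+-identityʳ (D v))))
    same : ∀ v → fire G w D v ≡ fire G w D' v
    same v rewrite D≗D' v = refl

  realizable-𝟙 : ∀ w → Realizable (𝟙 (w ==_))
  realizable-𝟙 w .realize {D} r = fwd (w , λ v → trans (r .at v) (sym (fire-laplacian w D v))) ◅ ε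

  realizable-+ : ∀ {f g} → Realizable f → Realizable g → Realizable (λ v → f v ℤ.+ g v)
  realizable-+ {f} {g} real-f real-g .realize {D} {D'} r =
    real-f .realize {D' = λ v → D v ℤ.+ Δ f v} (reaches λ _ → refl) ◅◅ real-g .realize (reaches λ v →
      trans (r .at v)
        (trans (cong (ℤ._+_ (D v)) (laplacian-+ f g v)) (sym (ℤ.+-assoc (D v) (Δ f v) (Δ g v)))))

  realizable-neg : ∀ {f} → Realizable f → Realizable (λ v → ℤ.- f v)
  realizable-neg {f} real .realize r = EqClosure.symmetric _
    (real .realize (reaches-cong (λ v → ℤ.neg-involutive (f v)) (reaches-neg r)))

  realizable-ℕ* : V → ∀ {f} n → Realizable f → Realizable (λ v → + n ℤ.* f v)
  realizable-ℕ* w     zero    real = realizable-0 w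
  realizable-ℕ* w {f} (suc n) real =
    realizable-cong (λ v → sym (ℤ.suc-* (+ n) (f v))) (realizable-+ real (realizable-ℕ* w n real))

  realizable-* : V → ∀ {f} z → Realizable f → Realizable (λ v → z ℤ.* f v)
  realizable-* w     (+ n)    real = realizable-ℕ* w n real
  realizable-* w {f} -[1+ n ] real =
    realizable-cong (λ v → ℤ.neg-distribˡ-* (+ suc n) (f v)) (realizable-neg (realizable-ℕ* w (suc n) real))

  realizable-sum : V → ∀ {k} (g : Fin k → V → ℤ) → (∀ i → Realizable (g i)) →
    Realizable (λ v → sumℤ (λ i → g i v))
  realizable-sum w {zero}  g real = realizable-0 w
  realizable-sum w {suc k} g real =
    realizable-+ (real zero) (realizable-sum w (g ∘ suc) (real ∘ suc))

  -- A script is the combination of vertex indicators with coefficients `f u`. The vertex `w`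
  -- supplies the firing that realizes the zero script.
  realizable : V → ∀ f → Realizable f
  realizable w f = realizable-cong
    (λ v → trans (ℤ∑.∑-cong (term v)) (ℤ∑.∑-select v f))
    (realizable-sum w (λ u v → f u ℤ.* 𝟙 (u ==_) v) (λ u → realizable-* w (f u) (realizable-𝟙 u)))
    where
    term : ∀ v u → f u ℤ.* 𝟙 (u ==_) v ≡ (if v == u then f u else 0ℤ)
    term v u rewrite ==-sym v u with u == v
    ... | true  = ℤ.*-identityʳ (f u)
    ... | false = ℤ.*-zeroʳ (f u)

-- Firing a set of vertices: chips, cuts and eggs.

Hits : {G : Graph} → Divisor G → Subset (size G) → Set
Hits {G} D E = ∃[ v ] v ∈ E × 0ℤ ℤ.< D v

hits? : ∀ {G} (D : Divisor G) E → Dec (Hits {G} D E)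
hits? D E = Fin.any? (λ v → (v Subset.∈? E) ×-dec (0ℤ ℤ.<? D v))

lookup-∁ : ∀ {n} (U : Subset n) x → lookup (∁ U) x ≡ not (lookup U x)
lookup-∁ U x = Vec.lookup-map x not U

∉⇒lookup≡false : ∀ {n} {U : Subset n} {x} → x ∉ U → lookup U x ≡ false
∉⇒lookup≡false {U = U} {x} x∉U with lookup U x in eq
... | false = refl
... | true  = contradiction (Vec.lookup⇒[]= x U eq) x∉U

lookup≡false⇒∈∁ : ∀ {n} {U : Subset n} {x} → lookup U x ≡ false → x ∈ ∁ U
lookup≡false⇒∈∁ {U = U} {x} eq = Vec.lookup⇒[]= x (∁ U) (trans (lookup-∁ U x) (cong not eq))

-- Follow the walk to the first vertex at which `b` is true; a vertex entered by the walk lies in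
-- `E`.
walk-crosses : ∀ {G} {E : Subset (size G)} (b : Fin (size G) → Bool) {x y} → WalkIn G E x y → x ∈ E →
  b x ≡ false → b y ≡ true →
  ∃[ u ] ∃[ v ] v ∈ E × b u ≡ false × b v ≡ true × 0 < edges G u v
walk-crosses b here _ bx by = contradiction (trans (sym by) bx) true≢false
walk-crosses b (step {w = w} e w∈E walk) x∈E bx by with b w in bw
... | true  = _ , _ , w∈E , bx , bw , e
... | false = walk-crosses b walk w∈E bw by

cut-outdegree : ∀ G U → cut G U ≡ sumℕ (λ v → if lookup U v then outdegree G (lookup U) v else 0)
cut-outdegree G U = ℕ∑.∑-cong (λ v → ℕ∑.∑-if (lookup U v) (λ w → if lookup U w then 0 else edges G v w))

module SubsetFiring (G : Graph) {U : Subset (size G)} {D D' : Divisor G}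
  (D≥0 : Effective {G} D) (D'≥0 : Effective {G} D') (r : Reaches G (𝟙 (lookup U)) D D') where

  -- A vertex of `U` pays its outdegree and is not in debt afterwards.
  outdegree≤chips : ∀ {v} → lookup U v ≡ true → + outdegree G (lookup U) v ℤ.≤ D v
  outdegree≤chips {v} v∈U = ℤ.0≤i-j⇒j≤i (subst (0ℤ ℤ.≤_)
    (trans (r .at v) (cong (ℤ._+_ (D v)) (laplacian-𝟙-inside G (lookup U) v v∈U))) (D'≥0 v))

  outside-gains : ∀ {v} → lookup U v ≡ false → D v ℤ.≤ D' v
  outside-gains {v} v∉U = subst (D v ℤ.≤_)
    (sym (trans (r .at v) (cong (ℤ._+_ (D v)) (laplacian-𝟙-outside G (lookup U) v v∉U))))
    (ℤ.i≤i+j (D v) (+ _))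

  -- Each edge of the cut carries away its own chip of `D`, and the vertices outside `U` are not in
  -- debt.
  cut≤deg : + cut G U ℤ.≤ deg {G} D
  cut≤deg = subst (ℤ._≤ deg {G} D)
    (sym (trans (cong +_ (cut-outdegree G U)) (pos-sum (λ v → if lookup U v then outdegree G (lookup U) v else 0))))
    (ℤ∑.∑-mono bound)
    where
    bound : ∀ v → + (if lookup U v then outdegree G (lookup U) v else 0) ℤ.≤ D v
    bound v with lookup U v in eq
    ... | true  = outdegree≤chips eq
    ... | false = D≥0 v

  -- If the egg met `U`, a walk inside it from `v` would enter `U` at a vertex with an edge leaving
  -- `U`. That vertex must hold a chip of `D`, so the egg would be hit.
  unhit-egg-outside : ∀ {E v} → InducesConnected G E → ¬ Hits {G} D E → v ∈ E → v ∉ U → E ⊆ ∁ U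
  unhit-egg-outside {E} {v} (_ , walk) unhit v∈E v∉U {y} y∈E with lookup U y in y∈U
  ... | false = lookup≡false⇒∈∁ {U = U} y∈U
  ... | true with walk-crosses (lookup U) (walk v y v∈E y∈E) v∈E (∉⇒lookup≡false v∉U) y∈U
  ... | a , b , b∈E , a∉U , b∈U , e = contradiction (b , b∈E , positive) unhit
    where
    edges≤outdegree : edges G b a ≤ outdegree G (lookup U) b
    edges≤outdegree = subst (_≤ outdegree G (lookup U) b) (cong (if_then 0 else edges G b a) a∉U)
      (ℕ∑.term≼∑ (λ w → if lookup U w then 0 else edges G b w) (λ _ → z≤n) a)
    positive : 0ℤ ℤ.< D b
    positive = ℤ.<-≤-trans
      (ℤ.+<+ (ℕ.<-≤-trans (subst (0 <_) (symmetric G a b) e) edges≤outdegree)) (outdegree≤chips b∈U)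

module _ (G : Graph) {U : Subset (size G)} {D D' : Divisor G}
  (D≥0 : Effective {G} D) (D'≥0 : Effective {G} D') (r : Reaches G (𝟙 (lookup U)) D D') where

  -- Undoing the firing of `U` is firing its complement, since the two indicators add up to a
  -- constant.
  reaches-∁ : Reaches G (𝟙 (lookup (∁ U))) D' D
  reaches-∁ = reaches-cong G complement (reaches-+ G (reaches-neg G r) (reaches-≗ G 1ℤ (λ _ → refl)))
    where
    complement : ∀ x → ℤ.- 𝟙 (lookup U) x ℤ.+ 1ℤ ≡ 𝟙 (lookup (∁ U)) x
    complement x rewrite lookup-∁ U x with lookup U x
    ... | true  = refl
    ... | false = refl

  -- The chip that hit the egg lay in `U`, because vertices outside `U` only gain. In the reversed
  -- firing the complement of `U` fires from `D'`, which misses the egg, so `unhit-egg-outside`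
  -- applies with the roles exchanged.
  newly-unhit-egg-inside : ∀ {E} → InducesConnected G E → Hits {G} D E → ¬ Hits {G} D' E → E ⊆ U
  newly-unhit-egg-inside {E} conn (w , w∈E , Dw>0) unhit {y} y∈E with w Subset.∈? U
  ... | no w∉U = contradiction
        (w , w∈E , ℤ.<-≤-trans Dw>0 (SubsetFiring.outside-gains G {U} {D} {D'} D≥0 D'≥0 r (∉⇒lookup≡false w∉U))) unhit
  ... | yes w∈U = Subset.x∉∁p⇒x∈p (Subset.x∈∁p⇒x∉p
        (SubsetFiring.unhit-egg-outside G {∁ U} {D'} {D} D'≥0 D≥0 reaches-∁ conn unhit w∈E (Subset.x∈p⇒x∉∁p w∈U) y∈E))

-- Executing the firing script f one level set {f > t} at a time, from the highest level downwards.
module Levels (G : Graph) (D : Divisor G) (f : Fin (size G) → ℤ) where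
  private
    V = Fin (size G)
    Δ = laplacian G

  -- For `t` above all values of `f` the truncated script is constant and the stage is `D`; for `t`
  -- below all of them the stage is `D + Δ f`.
  stage : ℤ → Divisor G
  stage t x = D x ℤ.+ Δ (λ y → f y ℤ.⊔ t) x

  -- Here `x` is a minimum of the truncated script, so it only receives chips.
  start≤stage : ∀ {t x} → f x ℤ.≤ t → D x ℤ.≤ stage t x
  start≤stage {t} {x} fx≤t = begin
    D x                                      ≡⟨ ℤ.+-identityʳ (D x) ⟨
    D x ℤ.+ 0ℤ                               ≡⟨ cong (ℤ._+_ (D x)) (ℤ∑.∑-ε {size G}) ⟨
    D x ℤ.+ sumℤ {size G} (λ _ → 0ℤ)         ≤⟨ ℤ.+-monoʳ-≤ (D x) (ℤ∑.∑-mono nonneg) ⟩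
    stage t x                                ∎
    where
    open ℤ.≤-Reasoning
    nonneg : ∀ w → 0ℤ ℤ.≤ + edges G x w ℤ.* ((f w ℤ.⊔ t) ℤ.- (f x ℤ.⊔ t))
    nonneg w = begin
      0ℤ                                                ≡⟨ ℤ.*-zeroʳ (+ edges G x w) ⟨
      + edges G x w ℤ.* 0ℤ
        ≤⟨ ℤ.*-monoˡ-≤-nonNeg (+ edges G x w) (ℤ.i≤j⇒0≤j-i (ℤ.i≤j⊔i (f w) t)) ⟩
      + edges G x w ℤ.* (f w ℤ.⊔ t ℤ.- t)
        ≡⟨ cong (λ z → + edges G x w ℤ.* (f w ℤ.⊔ t ℤ.- z)) (ℤ.i≤j⇒i⊔j≡j fx≤t) ⟨
      + edges G x w ℤ.* ((f w ℤ.⊔ t) ℤ.- (f x ℤ.⊔ t))       ∎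

  -- Truncation keeps the value at `x` and can only raise the values at its neighbours.
  end≤stage : ∀ {t x} → t ℤ.≤ f x → D x ℤ.+ Δ f x ℤ.≤ stage t x
  end≤stage {t} {x} t≤fx = ℤ.+-monoʳ-≤ (D x) (ℤ∑.∑-mono (λ w → ℤ.*-monoˡ-≤-nonNeg (+ edges G x w)
    (ℤ.+-mono-≤ (ℤ.i≤i⊔j (f w) t) (ℤ.≤-reflexive (cong ℤ.-_ (sym (ℤ.i≥j⇒i⊔j≡i t≤fx)))))))

  stage-effective : Effective {G} D → (∀ x → 0ℤ ℤ.≤ D x ℤ.+ Δ f x) → ∀ t → Effective {G} (stage t)
  stage-effective D≥0 end≥0 t x with ℤ.≤-total (f x) t
  ... | inj₁ fx≤t = ℤ.≤-trans (D≥0 x) (start≤stage fx≤t)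
  ... | inj₂ t≤fx = ℤ.≤-trans (end≥0 x) (end≤stage t≤fx)

  above : ℤ → Subset (size G)
  above t = tabulate (λ x → does (t ℤ.<? f x))

  above-∉ : ∀ {t x} → f x ℤ.≤ t → x ∉ above t
  above-∉ {t} {x} fx≤t x∈above with Vec.[]=⇒lookup x∈above
  ... | eq rewrite Vec.lookup∘tabulate (λ x → does (t ℤ.<? f x)) x with t ℤ.<? f x
  ... | yes t<fx = ℤ.<⇒≱ t<fx fx≤t

  reaches-stage : ∀ {t} → Reaches G (λ x → f x ℤ.⊔ t) D (stage t)
  reaches-stage = reaches λ _ → refl

  -- Passing from `f ⊔ (t + 1)` to `f ⊔ t` changes the script by 0 where `f > t` and by -1
  -- elsewhere; adding the constant 1 gives the indicator of `above t`.
  reaches-next : ∀ t → Reaches G (𝟙 (lookup (above t))) (stage (ℤ.suc t)) (stage t)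
  reaches-next t = reaches-cong G difference
    (reaches-+ G (reaches-neg G (reaches-stage {ℤ.suc t})) (reaches-+ G (reaches-stage {t}) (reaches-≗ G 1ℤ (λ _ → refl))))
    where
    inside : ∀ a → ℤ.- a ℤ.+ (a ℤ.+ 1ℤ) ≡ 1ℤ
    inside = solve-∀
    outside : ∀ t → ℤ.- (1ℤ ℤ.+ t) ℤ.+ (t ℤ.+ 1ℤ) ≡ 0ℤ
    outside = solve-∀
    difference : ∀ x → ℤ.- (f x ℤ.⊔ ℤ.suc t) ℤ.+ (f x ℤ.⊔ t ℤ.+ 1ℤ) ≡ 𝟙 (lookup (above t)) x
    difference x rewrite Vec.lookup∘tabulate (λ x → does (t ℤ.<? f x)) x with t ℤ.<? f x
    ... | yes t<fx rewrite ℤ.i≥j⇒i⊔j≡i (ℤ.<⇒≤ t<fx) | ℤ.i≥j⇒i⊔j≡i (ℤ.i<j⇒suc[i]≤j t<fx) = inside (f x)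
    ... | no  t≮fx rewrite ℤ.i≤j⇒i⊔j≡j (ℤ.≮⇒≥ t≮fx) | ℤ.i≤j⇒i⊔j≡j (ℤ.≤-trans (ℤ.≮⇒≥ t≮fx) (ℤ.i≤suc[i] t)) = outside t

-- Positive rank in terms of firing scripts.

minusVertex≤ : ∀ G (D : Divisor G) v x → minusVertex G D v x ℤ.≤ D x
minusVertex≤ G D v x with x == v
... | true  = ℤ.i≤j⇒i-k≤j 1ℤ ℤ.≤-refl
... | false = ℤ.≤-refl

-- Positive rank expressed by firing scripts instead of chains of single firings.
Winning : (G : Graph) → Divisor G → Set
Winning G D = ∀ v → ∃[ f ] ∀ x → 0ℤ ℤ.≤ minusVertex G D v x ℤ.+ laplacian G f x

positiveRank⇒winning : ∀ {G D} → PositiveRank G D → Winning G D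
positiveRank⇒winning {G} pr v with pr v
... | E , E≥0 , equiv with equiv⇒reaches G equiv
... | f , r = f , λ x → subst (0ℤ ℤ.≤_) (r .at x) (E≥0 x)

winning⇒positiveRank : ∀ {G D} → Winning G D → PositiveRank G D
winning⇒positiveRank {G} win v with win v
... | f , nonneg = _ , nonneg , realizable G v f .realize (reaches λ _ → refl)

module _ {G : Graph} {D : Divisor G} (win : Winning G D) where

  -- The chip removed at `v` is put back after the script has been executed.
  chip-at : ∀ v → ∃[ f ] Effective {G} (λ x → D x ℤ.+ laplacian G f x) × 0ℤ ℤ.< D v ℤ.+ laplacian G f v
  chip-at v with win v
  ... | f , nonneg = f ,
    (λ x → ℤ.≤-trans (nonneg x) (ℤ.+-monoˡ-≤ (laplacian G f x) (minusVertex≤ G D v x))) ,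
    ℤ.suc[i]≤j⇒i<j (subst (1ℤ ℤ.≤_) (restore (D v) (laplacian G f v)) (ℤ.+-monoʳ-≤ 1ℤ
      (subst (λ b → 0ℤ ℤ.≤ (if b then D v ℤ.- 1ℤ else D v) ℤ.+ laplacian G f v) (==-refl v) (nonneg v))))
    where
    restore : ∀ a b → 1ℤ ℤ.+ ((a ℤ.- 1ℤ) ℤ.+ b) ≡ a ℤ.+ b
    restore = solve-∀

-- The sum of all distances from `z` dominates each of them. Writing the bound as `z + k` makes a
-- descent to level `z` an induction on `k`.
upper-bound : ∀ {n} (f : Fin n → ℤ) z → ∃[ k ] ∀ x → f x ℤ.≤ z ℤ.+ + k
upper-bound f z = _ , λ x → ℤ.≤-trans (gap (f x))
  (ℤ.+-monoʳ-≤ z (ℤ.+≤+ (ℕ∑.term≼∑ (λ x → ℤ.∣ f x ℤ.- z ∣) (λ _ → z≤n) x)))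
  where
  rearrange : ∀ a z → a ≡ z ℤ.+ (a ℤ.- z)
  rearrange = solve-∀
  i≤∣i∣ : ∀ i → i ℤ.≤ + ℤ.∣ i ∣
  i≤∣i∣ (+ n)    = ℤ.≤-refl
  i≤∣i∣ -[1+ n ] = ℤ.-≤+
  gap : ∀ a → a ℤ.≤ z ℤ.+ + ℤ.∣ a ℤ.- z ∣
  gap a = subst (ℤ._≤ z ℤ.+ + ℤ.∣ a ℤ.- z ∣) (sym (rearrange a z)) (ℤ.+-monoʳ-≤ z (i≤∣i∣ (a ℤ.- z)))

-- The order of a scramble is at most the degree of a divisor of positive rank.

module ScrambleBound (G : Graph) (S : Scramble G) {m} (order : OrderAtLeast S m)
  {D : Divisor G} (win : Winning G D) (deg<m : deg {G} D ℤ.< + m) where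

  private Δ = laplacian G

  Keeps : Divisor G → Divisor G → Set
  Keeps D₁ D₂ = ∀ {E} → E ∈ₗ eggs S → Hits {G} D₁ E → Hits {G} D₂ E

  -- Storing the script from `D` gives, by subtraction, a script from `D₁` to any other divisor
  -- reached from `D`.
  record Candidate (D₁ : Divisor G) : Set where
    field
      script    : Fin (size G) → ℤ
      reached   : Reaches G script D D₁
      effective : Effective {G} D₁
  open Candidate

  egg-connected : ∀ {E} → E ∈ₗ eggs S → InducesConnected G E
  egg-connected = All.lookup (eggs-conn S)

  -- Such a `U` is an egg-cut, so `order` gives it at least `m` edges, more than the degree.
  no-cheap-cut : ∀ {U E E' D₁} → E ∈ₗ eggs S → E' ∈ₗ eggs S → E ⊆ U → E' ⊆ ∁ U →
    deg {G} D₁ ≡ deg {G} D → + cut G U ℤ.≤ deg {G} D₁ → ⊥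
  no-cheap-cut {U} E∈ E'∈ E⊆U E'⊆∁U same cut≤ = ℤ.<-irrefl refl (ℤ.<-≤-trans deg<m
    (ℤ.≤-trans (ℤ.+≤+ (proj₂ order U (lose E∈ E⊆U , lose E'∈ E'⊆∁U))) (subst (+ cut G U ℤ.≤_) same cut≤)))

  module _ {D₁} (cand : Candidate D₁) {E} (E∈ : E ∈ₗ eggs S) {v} (v∈E : v ∈ E)
    (f : Fin (size G) → ℤ) (end≥0 : ∀ x → 0ℤ ℤ.≤ D₁ x ℤ.+ Δ f x) (chip : 0ℤ ℤ.< D₁ v ℤ.+ Δ f v) where

    open Levels G D₁ f

    stage≥0 : ∀ t → Effective {G} (stage t)
    stage≥0 = stage-effective (cand .effective) end≥0

    deg-stage : ∀ t → deg {G} (stage t) ≡ deg {G} D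
    deg-stage t = trans (reaches-deg G (reaches-stage {t})) (reaches-deg G (cand .reached))

    -- An egg `E'` that stops being hit lies inside the fired set `above t`. The unhit egg `E`
    -- contains `v`, which is outside that set, so all of `E` is outside. The fired set would then
    -- be an egg-cut no larger than the degree.
    keeps-next : ∀ {t} → f v ℤ.≤ t → ¬ Hits {G} (stage (ℤ.suc t)) E → Keeps (stage (ℤ.suc t)) (stage t)
    keeps-next {t} fv≤t unhit {E'} E'∈ hit with hits? {G} (stage t) E'
    ... | yes hit'  = hit'
    ... | no unhit' = ⊥-elim (no-cheap-cut {above t} E'∈ E∈
      (newly-unhit-egg-inside G (stage≥0 (ℤ.suc t)) (stage≥0 t) (reaches-next t) (egg-connected E'∈) hit unhit')
      (unhit-egg-outside (egg-connected E∈) unhit v∈E (above-∉ fv≤t))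
      (deg-stage (ℤ.suc t)) cut≤deg)
      where open SubsetFiring G {above t} {stage (ℤ.suc t)} {stage t} (stage≥0 (ℤ.suc t)) (stage≥0 t) (reaches-next t)

    -- The descent stops at the first level whose stage hits `E`. This is at the latest level `f v`,
    -- where `v` already holds at least its final number of chips. Before that `E` is unhit, which
    -- is what `keeps-next` requires.
    descend : ∀ k → ∃[ t ] Hits {G} (stage t) E × Keeps (stage (f v ℤ.+ + k)) (stage t)
    descend zero = f v ℤ.+ 0ℤ ,
      (v , v∈E , ℤ.<-≤-trans chip (end≤stage (ℤ.≤-reflexive (ℤ.+-identityʳ (f v))))) , λ _ → id
    descend (suc k) with hits? {G} (stage (f v ℤ.+ + suc k)) E
    ... | yes hit  = _ , hit , λ _ → id
    ... | no unhit with descend k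
    ... | t , hit , keeps = t , hit , λ E'∈ hit' → keeps E'∈
          (keeps-next (ℤ.i≤i+j (f v) (+ k)) (subst (λ s → ¬ Hits {G} (stage s) E) next unhit) E'∈
            (subst (λ s → Hits {G} (stage s) _) next hit'))
      where
      shuffle : ∀ a b → a ℤ.+ (1ℤ ℤ.+ b) ≡ 1ℤ ℤ.+ (a ℤ.+ b)
      shuffle = solve-∀
      next : f v ℤ.+ + suc k ≡ ℤ.suc (f v ℤ.+ + k)
      next = shuffle (f v) (+ k)

    hit-by-descent : ∃[ D₂ ] Candidate D₂ × Hits {G} D₂ E × Keeps D₁ D₂
    hit-by-descent with upper-bound f (f v)
    ... | k , f≤top with descend k
    ... | t , hit , keeps = stage t ,
      record { reached = reaches-+ G (cand .reached) (reaches-stage {t}) ; effective = stage≥0 t } ,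
      -- The descent starts above all values of `f`, where no vertex has fewer chips than in `D₁`.
      hit , λ E'∈ (w , w∈E' , chip-w) → keeps E'∈ (w , w∈E' , ℤ.<-≤-trans chip-w (start≤stage (f≤top w)))

  hit-one-more : ∀ {D₁ E} → Candidate D₁ → E ∈ₗ eggs S → ∃[ D₂ ] Candidate D₂ × Hits {G} D₂ E × Keeps D₁ D₂
  hit-one-more {D₁} {E} cand E∈ with egg-connected E∈
  ... | (v , v∈E) , _ with chip-at {G} {D} win v
  -- Undo the script of the candidate, then execute the script that puts a chip on a vertex of the
  -- egg.
  ... | f , end≥0 , chip = hit-by-descent cand E∈ v∈E (λ x → ℤ.- cand .script x ℤ.+ f x)
      (λ x → subst (0ℤ ℤ.≤_) (onward .at x) (end≥0 x)) (subst (0ℤ ℤ.<_) (onward .at v) chip)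
    where
    onward : Reaches G (λ x → ℤ.- cand .script x ℤ.+ f x) D₁ (λ x → D x ℤ.+ Δ f x)
    onward = reaches-+ G (reaches-neg G (cand .reached)) (reaches λ _ → refl)

  HitsAll : List (Subset (size G)) → Set
  HitsAll es = ∃[ D₁ ] Candidate D₁ × (∀ {E} → E ∈ₗ es → Hits {G} D₁ E)

  -- `D` itself may have debts, so the search starts from an effective divisor equivalent to it.
  hit-none : Fin (size G) → HitsAll []
  hit-none v = let f , nonneg , _ = chip-at {G} {D} win v in
    (λ x → D x ℤ.+ Δ f x) , record { script = f ; reached = reaches (λ _ → refl) ; effective = nonneg } , λ ()

  extend : ∀ {E es} → E ∈ₗ eggs S → (∀ {E'} → E' ∈ₗ es → E' ∈ₗ eggs S) → HitsAll es → HitsAll (E ∷ es)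
  extend {E} {es} E∈ es⊆ (D₁ , cand , hits) = let D₂ , cand' , hit , keeps = hit-one-more cand E∈ in
    D₂ , cand' , λ { (here refl) → hit ; (there E'∈) → keeps (es⊆ E'∈) (hits E'∈) }

  hit-all : Fin (size G) → ∀ es → (∀ {E} → E ∈ₗ es → E ∈ₗ eggs S) → HitsAll es
  hit-all v []       _   = hit-none v
  hit-all v (E ∷ es) es⊆ = extend (es⊆ (here refl)) (es⊆ ∘ there) (hit-all v es (es⊆ ∘ there))

card-sum : ∀ {n} (X : Subset n) → ∣ X ∣ ≡ sumℕ (λ x → if lookup X x then 1 else 0)
card-sum []          = refl
card-sum (true ∷ X)  = cong suc (card-sum X)
card-sum (false ∷ X) = card-sum X

-- The support of `D` is a hitting set, and each of its vertices carries at least one chip.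
hitting-divisor-degree : ∀ {G} (S : Scramble G) {m D} → OrderAtLeast S m → Effective {G} D →
  (∀ {E} → E ∈ₗ eggs S → Hits {G} D E) → + m ℤ.≤ deg {G} D
hitting-divisor-degree {G} S {m} {D} order D≥0 hits =
  ℤ.≤-trans (ℤ.+≤+ (proj₁ order support (All.tabulate hitting))) support≤deg
  where
  occupied : Fin (size G) → Bool
  occupied x = does (0ℤ ℤ.<? D x)
  support : Subset (size G)
  support = tabulate occupied
  hitting : ∀ {E} → E ∈ₗ eggs S → Nonempty (support ∩ E)
  hitting E∈ = let x , x∈E , chip = hits E∈ in x , Subset.x∈p∩q⁺
    (Vec.lookup⇒[]= x support (trans (Vec.lookup∘tabulate occupied x) (dec-true (0ℤ ℤ.<? D x) chip)) , x∈E)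
  one-chip : ∀ x → + (if lookup support x then 1 else 0) ℤ.≤ D x
  one-chip x rewrite Vec.lookup∘tabulate occupied x with 0ℤ ℤ.<? D x
  ... | yes chip = ℤ.i<j⇒suc[i]≤j chip
  ... | no  _    = D≥0 x
  support≤deg : + ∣ support ∣ ℤ.≤ deg {G} D
  support≤deg = subst (ℤ._≤ deg {G} D)
    (sym (trans (cong +_ (card-sum support)) (pos-sum (λ x → if lookup support x then 1 else 0))))
    (ℤ∑.∑-mono one-chip)

-- A degree below `m` would rule out cheap egg-cuts, hence allow all eggs to be hit at once, which
-- already takes `m` chips.
scramble≤degree : ∀ G (S : Scramble G) {m D} → Fin (size G) → OrderAtLeast S m → PositiveRank G D →
  + m ℤ.≤ deg {G} D
scramble≤degree G S {m} {D} v order pr = decidable-stable (+ m ℤ.≤? deg {G} D) λ m≰deg →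
  let open ScrambleBound G S order (positiveRank⇒winning {G} {D} pr) (ℤ.≰⇒> m≰deg)
      D₁ , cand , hits = hit-all v (eggs S) id
      open Candidate cand
  in m≰deg (subst (+ m ℤ.≤_) (reaches-deg G reached) (hitting-divisor-degree S order effective hits))

-- The script for `π v` pulls back. Taking one chip from `v` leaves at least as much as taking one
-- from every vertex of the fibre of `π v`.
winning-pullback : ∀ {G P} (π : Fin (size P) → Fin (size G)) →
  (∀ f x → laplacian P (f ∘ π) x ≡ laplacian G f (π x)) →
  ∀ {D} → Winning G D → Winning P (D ∘ π)
winning-pullback {G} {P} π laplacian-π {D} win v = let f , nonneg = win (π v) in
  f ∘ π , λ x → ℤ.≤-trans (nonneg (π x)) (ℤ.+-mono-≤ (bound x) (ℤ.≤-reflexive (sym (laplacian-π f x))))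
  where
  bound : ∀ x → minusVertex G D (π v) (π x) ℤ.≤ minusVertex P (D ∘ π) v x
  bound x with x == v in eq
  ... | false = minusVertex≤ G D (π v) (π x)
  ... | true rewrite ==⇒≡ eq | ==-refl (π v) = ℤ.≤-refl

-- The Cartesian product: projections, degrees and cuts.

module Product (G H : Graph) where
  private
    P = G □ H

  π₁ : Fin (size P) → Fin (size G)
  π₁ x = proj₁ (remQuot {size G} (size H) x)

  π₂ : Fin (size P) → Fin (size H)
  π₂ x = proj₂ (remQuot {size G} (size H) x)

  π₁-combine : ∀ u v → π₁ (combine u v) ≡ u
  π₁-combine u v = cong proj₁ (Fin.remQuot-combine {size G} {size H} u v)

  π₂-combine : ∀ u v → π₂ (combine u v) ≡ v
  π₂-combine u v = cong proj₂ (Fin.remQuot-combine {size G} {size H} u v)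

  combine-π : ∀ x → combine (π₁ x) (π₂ x) ≡ x
  combine-π = Fin.combine-remQuot {size G} (size H)

  edges-combine : ∀ u v a b → edges P (combine u v) (combine a b) ≡ prodEdges G H (u , v) (a , b)
  edges-combine u v a b = cong₂ (prodEdges G H)
    (Fin.remQuot-combine {size G} {size H} u v) (Fin.remQuot-combine {size G} {size H} a b)

  -- `f ∘ π₁` is constant along the edges coming from `H`, and the remaining edges at `x` are those
  -- of `G` at `π₁ x`.
  laplacian-π₁ : ∀ f x → laplacian P (f ∘ π₁) x ≡ laplacian G f (π₁ x)
  laplacian-π₁ f x = begin
    laplacian P (f ∘ π₁) x
      ≡⟨ ℤ∑.∑-combine (size G) (size H) (λ y → + edges P x y ℤ.* (f (π₁ y) ℤ.- f u)) ⟩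
    sumℤ (λ (a : Fin (size G)) → sumℤ (λ (b : Fin (size H)) → + edges P x (combine a b) ℤ.* (f (π₁ (combine a b)) ℤ.- f u)))
      ≡⟨ ℤ∑.∑-cong (λ a → ℤ∑.∑-cong (λ b → term a b)) ⟩
    sumℤ (λ a → sumℤ (λ b → if v == b then + edges G u a ℤ.* (f a ℤ.- f u) else 0ℤ))
      ≡⟨ ℤ∑.∑-cong (λ a → ℤ∑.∑-select v (λ _ → + edges G u a ℤ.* (f a ℤ.- f u))) ⟩
    laplacian G f u                                                              ∎
    where
    open ≡-Reasoning
    u = π₁ x
    v = π₂ x
    vanish : ∀ c → c ℤ.* (f u ℤ.- f u) ≡ 0ℤ
    vanish c = trans (cong (c ℤ.*_) (ℤ.+-inverseʳ (f u))) (ℤ.*-zeroʳ c)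
    pointwise : ∀ a b → + prodEdges G H (u , v) (a , b) ℤ.* (f a ℤ.- f u) ≡
      (if v == b then + edges G u a ℤ.* (f a ℤ.- f u) else 0ℤ)
    pointwise a b with u == a in eq
    ... | true rewrite sym (==⇒≡ eq) with v == b
    -- The summand of `x` itself: both sides carry the factor `f u - f u`.
    ...   | true  = trans (vanish (+ edges H v b)) (sym (vanish (+ edges G u u)))
    ...   | false = vanish (+ edges H v b)
    pointwise a b | false with v == b
    ...   | true  = refl
    ...   | false = refl
    term : ∀ a b → + edges P x (combine a b) ℤ.* (f (π₁ (combine a b)) ℤ.- f u) ≡
      (if v == b then + edges G u a ℤ.* (f a ℤ.- f u) else 0ℤ)
    term a b = trans
      (cong (λ (c , d) → + prodEdges G H (u , v) (c , d) ℤ.* (f c ℤ.- f u)) (Fin.remQuot-combine {size G} {size H} a b))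
      (pointwise a b)

  laplacian-π₂ : ∀ f x → laplacian P (f ∘ π₂) x ≡ laplacian H f (π₂ x)
  laplacian-π₂ f x = begin
    laplacian P (f ∘ π₂) x
      ≡⟨ ℤ∑.∑-combine (size G) (size H) (λ y → + edges P x y ℤ.* (f (π₂ y) ℤ.- f v)) ⟩
    sumℤ (λ (a : Fin (size G)) → sumℤ (λ (b : Fin (size H)) → + edges P x (combine a b) ℤ.* (f (π₂ (combine a b)) ℤ.- f v)))
      ≡⟨ ℤ∑.∑-cong (λ a → ℤ∑.∑-cong (λ b → term a b)) ⟩
    sumℤ (λ a → sumℤ (λ b → if u == a then + edges H v b ℤ.* (f b ℤ.- f v) else 0ℤ))
      ≡⟨ ℤ∑.∑-cong (λ a → ℤ∑.∑-if (u == a) (λ b → + edges H v b ℤ.* (f b ℤ.- f v))) ⟩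
    sumℤ (λ a → if u == a then laplacian H f v else 0ℤ)
      ≡⟨ ℤ∑.∑-select u (λ _ → laplacian H f v) ⟩
    laplacian H f v                                                              ∎
    where
    open ≡-Reasoning
    u = π₁ x
    v = π₂ x
    pointwise : ∀ a b → + prodEdges G H (u , v) (a , b) ℤ.* (f b ℤ.- f v) ≡
      (if u == a then + edges H v b ℤ.* (f b ℤ.- f v) else 0ℤ)
    pointwise a b with u == a
    ... | true = refl
    ... | false with v == b in eq
    ...   | true rewrite sym (==⇒≡ eq) =
            trans (cong (+ edges G u a ℤ.*_) (ℤ.+-inverseʳ (f v))) (ℤ.*-zeroʳ (+ edges G u a))
    ...   | false = refl
    term : ∀ a b → + edges P x (combine a b) ℤ.* (f (π₂ (combine a b)) ℤ.- f v) ≡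
      (if u == a then + edges H v b ℤ.* (f b ℤ.- f v) else 0ℤ)
    term a b = trans
      (cong (λ (c , d) → + prodEdges G H (u , v) (c , d) ℤ.* (f d ℤ.- f v)) (Fin.remQuot-combine {size G} {size H} a b))
      (pointwise a b)

  deg-π₁ : ∀ D → deg {P} (D ∘ π₁) ≡ + size H ℤ.* deg {G} D
  deg-π₁ D = begin
    deg {P} (D ∘ π₁)
      ≡⟨ ℤ∑.∑-combine (size G) (size H) (D ∘ π₁) ⟩
    sumℤ (λ (u : Fin (size G)) → sumℤ (λ (v : Fin (size H)) → D (π₁ (combine u v))))
      ≡⟨ ℤ∑.∑-cong (λ u → ℤ∑.∑-cong (λ v → cong D (π₁-combine u v))) ⟩
    sumℤ (λ u → sumℤ {size H} (λ _ → D u))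
      ≡⟨ ℤ∑.∑-swap {size G} {size H} (λ u _ → D u) ⟩
    sumℤ {size H} (λ _ → deg {G} D)                            ≡⟨ sumℤ-const (size H) (deg {G} D) ⟩
    + size H ℤ.* deg {G} D                                     ∎
    where open ≡-Reasoning

  deg-π₂ : ∀ D → deg {P} (D ∘ π₂) ≡ + size G ℤ.* deg {H} D
  deg-π₂ D = begin
    deg {P} (D ∘ π₂)
      ≡⟨ ℤ∑.∑-combine (size G) (size H) (D ∘ π₂) ⟩
    sumℤ (λ (u : Fin (size G)) → sumℤ (λ (v : Fin (size H)) → D (π₂ (combine u v))))
      ≡⟨ ℤ∑.∑-cong (λ u → ℤ∑.∑-cong (λ v → cong D (π₂-combine u v))) ⟩
    sumℤ {size G} (λ _ → deg {H} D)                            ≡⟨ sumℤ-const (size G) (deg {H} D) ⟩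
    + size G ℤ.* deg {H} D                                     ∎
    where open ≡-Reasoning

  positiveRank-π₁ : ∀ {D} → PositiveRank G D → PositiveRank P (D ∘ π₁)
  positiveRank-π₁ {D} pr = winning⇒positiveRank {P} {D ∘ π₁}
    (winning-pullback {G} {P} π₁ laplacian-π₁ {D} (positiveRank⇒winning {G} {D} pr))

  positiveRank-π₂ : ∀ {D} → PositiveRank H D → PositiveRank P (D ∘ π₂)
  positiveRank-π₂ {D} pr = winning⇒positiveRank {P} {D ∘ π₂}
    (winning-pullback {H} {P} π₂ laplacian-π₂ {D} (positiveRank⇒winning {H} {D} pr))

  column : Subset (size P) → Fin (size G) → Subset (size H)
  column A u = tabulate (λ v → lookup A (combine u v))

  row : Subset (size P) → Fin (size H) → Subset (size G)
  row A v = tabulate (λ u → lookup A (combine u v))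

  lookup-column : ∀ A u v → lookup (column A u) v ≡ lookup A (combine u v)
  lookup-column A u = Vec.lookup∘tabulate (λ v → lookup A (combine u v))

  lookup-row : ∀ A v u → lookup (row A v) u ≡ lookup A (combine u v)
  lookup-row A v = Vec.lookup∘tabulate (λ u → lookup A (combine u v))

  -- Every edge of the product lies in exactly one column or exactly one row.
  cut-□ : ∀ A → cut P A ≡ sumℕ (λ u → cut H (column A u)) + sumℕ (λ v → cut G (row A v))
  cut-□ A = begin
    cut P A
      ≡⟨ ℕ∑.∑-combine (size G) (size H) (λ x → sumℕ (λ y → crossing (lookup A x) (lookup A y) (edges P x y))) ⟩
    sumℕ (λ u → sumℕ (λ v → sumℕ (λ y → crossing (α u v) (lookup A y) (edges P (combine u v) y))))
      ≡⟨ ℕ∑.∑-cong (λ u → ℕ∑.∑-cong (λ v → at-vertex u v)) ⟩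
    sumℕ (λ u → sumℕ (λ v → sumℕ (λ b → C u v b) + sumℕ (λ a → R v u a)))
      ≡⟨ ℕ∑.∑-cong (λ u → ℕ∑.∑-∙ (λ v → sumℕ (C u v)) (λ v → sumℕ (R v u))) ⟩
    sumℕ (λ u → sumℕ (λ v → sumℕ (C u v)) + sumℕ (λ v → sumℕ (R v u)))
      ≡⟨ ℕ∑.∑-∙ (λ u → sumℕ (λ v → sumℕ (C u v))) (λ u → sumℕ (λ v → sumℕ (R v u))) ⟩
    sumℕ (λ u → sumℕ (λ v → sumℕ (C u v))) + sumℕ (λ u → sumℕ (λ v → sumℕ (R v u)))
      ≡⟨ cong₂ _+_ (ℕ∑.∑-cong columns) (trans (ℕ∑.∑-swap (λ u v → sumℕ (R v u))) (ℕ∑.∑-cong rows)) ⟩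
    sumℕ (λ u → cut H (column A u)) + sumℕ (λ v → cut G (row A v)) ∎
    where
    open ≡-Reasoning
    crossing : Bool → Bool → ℕ → ℕ
    crossing p q k = if p then (if q then 0 else k) else 0
    α : Fin (size G) → Fin (size H) → Bool
    α u v = lookup A (combine u v)
    C : Fin (size G) → Fin (size H) → Fin (size H) → ℕ
    C u v b = crossing (α u v) (α u b) (edges H v b)
    R : Fin (size H) → Fin (size G) → Fin (size G) → ℕ
    R v u a = crossing (α u v) (α a v) (edges G u a)

    crossing-same : ∀ p k → crossing p p k ≡ 0
    crossing-same true  k = refl
    crossing-same false k = refl
    crossing-0 : ∀ p q → crossing p q 0 ≡ 0
    crossing-0 true  true  = refl
    crossing-0 true  false = refl
    crossing-0 false q     = refl

    pointwise : ∀ u v a b → crossing (α u v) (α a b) (prodEdges G H (u , v) (a , b)) ≡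
      (if u == a then C u v b else 0) + (if v == b then R v u a else 0)
    pointwise u v a b with u == a in u=a
    ... | true rewrite sym (==⇒≡ u=a) with v == b
    -- Here both conditions hold; the row term compares a vertex with itself and vanishes.
    ...   | true  = sym (trans (cong (ℕ._+_ (C u v b)) (crossing-same (α u v) (edges G u u))) (ℕ.+-identityʳ _))
    ...   | false = sym (ℕ.+-identityʳ _)
    pointwise u v a b | false with v == b in v=b
    ...   | true rewrite sym (==⇒≡ v=b) = refl
    ...   | false = crossing-0 (α u v) (α a b)

    at-vertex : ∀ u v → sumℕ (λ y → crossing (α u v) (lookup A y) (edges P (combine u v) y)) ≡
      sumℕ (C u v) + sumℕ (R v u)
    at-vertex u v = begin
      sumℕ (λ y → crossing (α u v) (lookup A y) (edges P (combine u v) y))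
        ≡⟨ ℕ∑.∑-combine (size G) (size H) (λ y → crossing (α u v) (lookup A y) (edges P (combine u v) y)) ⟩
      sumℕ (λ a → sumℕ (λ b → crossing (α u v) (α a b) (edges P (combine u v) (combine a b))))
        ≡⟨ ℕ∑.∑-cong (λ a → ℕ∑.∑-cong (λ b → trans (cong (crossing (α u v) (α a b)) (edges-combine u v a b)) (pointwise u v a b))) ⟩
      sumℕ (λ a → sumℕ (λ b → (if u == a then C u v b else 0) + (if v == b then R v u a else 0)))
        ≡⟨ ℕ∑.∑-cong (λ a → ℕ∑.∑-∙ (λ b → if u == a then C u v b else 0) (λ b → if v == b then R v u a else 0)) ⟩
      sumℕ (λ a → sumℕ (λ b → if u == a then C u v b else 0) + sumℕ (λ b → if v == b then R v u a else 0))
        ≡⟨ ℕ∑.∑-cong (λ a → cong₂ _+_ (ℕ∑.∑-if (u == a) (C u v)) (ℕ∑.∑-select v (λ _ → R v u a))) ⟩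
      sumℕ (λ a → (if u == a then sumℕ (C u v) else 0) + R v u a)
        ≡⟨ ℕ∑.∑-∙ (λ a → if u == a then sumℕ (C u v) else 0) (R v u) ⟩
      sumℕ (λ a → if u == a then sumℕ (C u v) else 0) + sumℕ (R v u)
        ≡⟨ cong (ℕ._+ sumℕ (R v u)) (ℕ∑.∑-select u (λ _ → sumℕ (C u v))) ⟩
      sumℕ (C u v) + sumℕ (R v u) ∎

    columns : ∀ u → sumℕ (λ v → sumℕ (C u v)) ≡ cut H (column A u)
    columns u = ℕ∑.∑-cong (λ v → ℕ∑.∑-cong (λ b →
      sym (cong₂ (λ p q → crossing p q (edges H v b)) (lookup-column A u v) (lookup-column A u b))))
    rows : ∀ v → sumℕ (λ u → sumℕ (R v u)) ≡ cut G (row A v)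
    rows v = ℕ∑.∑-cong (λ u → ℕ∑.∑-cong (λ a →
      sym (cong₂ (λ p q → crossing p q (edges G u a)) (lookup-row A v u) (lookup-row A v a))))

-- Counting estimates for egg-cuts.

∈∁⁅⁆⇒≢ : ∀ {n} {x y : Fin n} → x ∈ ∁ ⁅ y ⁆ → x ≢ y
∈∁⁅⁆⇒≢ {x = x} x∈ refl = Subset.x∈∁p⇒x∉p x∈ (Subset.x∈⁅x⁆ x)

two-terms≤∑ : ∀ {n} (f : Fin n → ℕ) {i j} → i ≢ j → f i + f j ≤ sumℕ f
two-terms≤∑ f {i} {j} i≢j = begin
  f i + f j
    ≡⟨ cong₂ _+_ (ℕ∑.∑-select i f) (ℕ∑.∑-select j f) ⟨
  sumℕ (λ x → if i == x then f x else 0) + sumℕ (λ x → if j == x then f x else 0)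
    ≡⟨ ℕ∑.∑-∙ (λ x → if i == x then f x else 0) (λ x → if j == x then f x else 0) ⟨
  sumℕ (λ x → (if i == x then f x else 0) + (if j == x then f x else 0))
    ≤⟨ ℕ∑.∑-mono bound ⟩
  sumℕ f ∎
  where
  open ℕ.≤-Reasoning
  bound : ∀ x → (if i == x then f x else 0) + (if j == x then f x else 0) ≤ f x
  bound x with i == x in i=x | j == x in j=x
  ... | true  | true  = contradiction (trans (==⇒≡ i=x) (sym (==⇒≡ j=x))) i≢j
  ... | true  | false = ℕ.≤-reflexive (ℕ.+-identityʳ (f x))
  ... | false | true  = ℕ.≤-refl
  ... | false | false = z≤n

-- Adding `l` to the exceptional term makes every term at least `l`.
n*l≤∑+exception : ∀ {n} (f : Fin n → ℕ) {l} i → (∀ x → x ≢ i → l ≤ f x) → n * l ≤ sumℕ f + l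
n*l≤∑+exception {n} f {l} i l≤f = begin
  n * l                                              ≡⟨ sumℕ-const n l ⟨
  sumℕ {n} (λ _ → l)                                 ≤⟨ ℕ∑.∑-mono bound ⟩
  sumℕ (λ x → f x + (if i == x then l else 0))       ≡⟨ ℕ∑.∑-∙ f (λ x → if i == x then l else 0) ⟩
  sumℕ f + sumℕ (λ x → if i == x then l else 0)      ≡⟨ cong (ℕ._+_ (sumℕ f)) (ℕ∑.∑-select i (λ _ → l)) ⟩
  sumℕ f + l                                         ∎
  where
  open ℕ.≤-Reasoning
  bound : ∀ x → l ≤ f x + (if i == x then l else 0)
  bound x with i == x in i=x
  ... | true  = ℕ.m≤n+m l (f x)
  ... | false = ℕ.≤-trans (l≤f x (==-false⇒≢ i=x ∘ sym)) (ℕ.m≤m+n (f x) 0)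

n*l≤∑+exceptions : ∀ {n} (f : Fin n → ℕ) {l} i j → (∀ x → x ≢ i → x ≢ j → l ≤ f x) → n * l ≤ sumℕ f + (l + l)
n*l≤∑+exceptions {n} f {l} i j l≤f = begin
  n * l
    ≤⟨ n*l≤∑+exception (λ x → f x + (if i == x then l else 0)) j bound ⟩
  sumℕ (λ x → f x + (if i == x then l else 0)) + l
    ≡⟨ cong (ℕ._+ l) (ℕ∑.∑-∙ f (λ x → if i == x then l else 0)) ⟩
  sumℕ f + sumℕ (λ x → if i == x then l else 0) + l
    ≡⟨ cong (λ k → sumℕ f + k + l) (ℕ∑.∑-select i (λ _ → l)) ⟩
  sumℕ f + l + l                                         ≡⟨ ℕ.+-assoc (sumℕ f) l l ⟩
  sumℕ f + (l + l)                                       ∎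
  where
  open ℕ.≤-Reasoning
  bound : ∀ x → x ≢ j → l ≤ f x + (if i == x then l else 0)
  bound x x≢j with i == x in i=x
  ... | true  = ℕ.m≤n+m l (f x)
  ... | false = ℕ.≤-trans (l≤f x (==-false⇒≢ i=x ∘ sym) x≢j) (ℕ.m≤m+n (f x) 0)

avoid-two : ∀ {n} → 2 < n → (i j : Fin n) → ∃[ x ] x ≢ i × x ≢ j
avoid-two (s≤s (s≤s (s≤s _))) zero          zero          = suc zero , (λ ()) , (λ ())
avoid-two (s≤s (s≤s (s≤s _))) zero          (suc zero)    = suc (suc zero) , (λ ()) , (λ ())
avoid-two (s≤s (s≤s (s≤s _))) zero          (suc (suc _)) = suc zero , (λ ()) , (λ ())
avoid-two (s≤s (s≤s (s≤s _))) (suc zero)    zero          = suc (suc zero) , (λ ()) , (λ ())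
avoid-two (s≤s (s≤s (s≤s _))) (suc (suc _)) zero          = suc zero , (λ ()) , (λ ())
avoid-two (s≤s (s≤s (s≤s _))) (suc _)       (suc _)       = zero , (λ ()) , (λ ())

-- Every edge at `u` crosses the cut and is counted there from its other end.
val≤cut-without : ∀ G A {u} → lookup A u ≡ false → (∀ x → x ≢ u → lookup A x ≡ true) → val G u ≤ cut G A
val≤cut-without G A {u} u∉A others = begin
  val G u                                                             ≡⟨ ℕ∑.∑-cong (symmetric G u) ⟩
  sumℕ (λ x → edges G x u)                                            ≤⟨ ℕ∑.∑-mono bound ⟩
  sumℕ (λ x → if lookup A x then outdegree G (lookup A) x else 0)     ≡⟨ cut-outdegree G A ⟨
  cut G A                                                             ∎
  where
  open ℕ.≤-Reasoning
  bound : ∀ x → edges G x u ≤ (if lookup A x then outdegree G (lookup A) x else 0)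
  bound x with x ≟ u
  ... | yes refl = ℕ.≤-trans (ℕ.≤-reflexive (loopless G x)) z≤n
  ... | no x≢u rewrite others x x≢u =
    subst (_≤ outdegree G (lookup A) x) (cong (if_then 0 else edges G x u) u∉A)
      (ℕ∑.term≼∑ (λ w → if lookup A w then 0 else edges G x w) (λ _ → z≤n) u)

val≤cut-only : ∀ G A {u} → lookup A u ≡ true → (∀ x → x ≢ u → lookup A x ≡ false) → val G u ≤ cut G A
val≤cut-only G A {u} u∈A others = begin
  val G u                                                             ≤⟨ ℕ∑.∑-mono bound ⟩
  outdegree G (lookup A) u
    ≡⟨ cong (if_then outdegree G (lookup A) u else 0) u∈A ⟨
  (if lookup A u then outdegree G (lookup A) u else 0)
    ≤⟨ ℕ∑.term≼∑ (λ x → if lookup A x then outdegree G (lookup A) x else 0) (λ _ → z≤n) u ⟩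
  sumℕ (λ x → if lookup A x then outdegree G (lookup A) x else 0)     ≡⟨ cut-outdegree G A ⟨
  cut G A                                                             ∎
  where
  open ℕ.≤-Reasoning
  bound : ∀ x → edges G u x ≤ (if lookup A x then 0 else edges G u x)
  bound x with x ≟ u
  ... | yes refl = ℕ.≤-trans (ℕ.≤-reflexive (loopless G x)) z≤n
  ... | no x≢u rewrite others x x≢u = ℕ.≤-refl

-- Twice the claim is the sum of the first two hypotheses.
average-bound : ∀ {k nl l d C R} → k ≤ nl → k + 2 * l ≤ nl + 2 * d →
  nl ≤ C + l → d ≤ R → k ≤ C + R
average-bound {k} {nl} {l} {d} {C} {R} k≤nl k+2l≤ nl≤ d≤R = ℕ.+-cancelʳ-≤ l k (C + R) (begin
  k + l            ≤⟨ ℕ.*-cancelˡ-≤ 2 doubled ⟩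
  nl + d           ≤⟨ ℕ.+-mono-≤ nl≤ d≤R ⟩
  C + l + R        ≡⟨ ℕ.+-assoc C l R ⟩
  C + (l + R)      ≡⟨ cong (ℕ._+_ C) (ℕ.+-comm l R) ⟩
  C + (R + l)      ≡⟨ ℕ.+-assoc C R l ⟨
  C + R + l        ∎)
  where
  open ℕ.≤-Reasoning
  split : ∀ a b → 2 * (a + b) ≡ a + (a + 2 * b)
  split = ℕ-solve-∀
  doubled : 2 * (k + l) ≤ 2 * (nl + d)
  doubled = begin
    2 * (k + l)          ≡⟨ split k l ⟩
    k + (k + 2 * l)      ≤⟨ ℕ.+-mono-≤ k≤nl k+2l≤ ⟩
    nl + (nl + 2 * d)    ≡⟨ split nl d ⟨
    2 * (nl + d)         ∎

-- Two lost columns cost `2 * l` and two rows bring in `2 * d`; the first hypothesis is the balance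
-- of this exchange.
double-bound : ∀ {k nl l d C R} → k + 2 * l ≤ nl + 2 * d → nl ≤ C + (l + l) → d + d ≤ R → k ≤ C + R
double-bound {k} {nl} {l} {d} {C} {R} k+2l≤ nl≤ 2d≤R = ℕ.+-cancelʳ-≤ (2 * l) k (C + R) (begin
  k + 2 * l              ≤⟨ k+2l≤ ⟩
  nl + 2 * d             ≤⟨ ℕ.+-mono-≤ nl≤ (ℕ.≤-trans (ℕ.≤-reflexive (twice d)) 2d≤R) ⟩
  C + (l + l) + R        ≡⟨ shuffle C l R ⟩
  C + R + 2 * l          ∎)
  where
  open ℕ.≤-Reasoning
  twice : ∀ a → 2 * a ≡ a + a
  twice = ℕ-solve-∀
  shuffle : ∀ C l R → C + (l + l) + R ≡ C + R + 2 * l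
  shuffle = ℕ-solve-∀

-- The scramble of punctured copies of `G` and its order.

module PuncturedCopies (G H : Graph) (κ≥2 : VertexConnAtLeast 2 G) where
  open Product G H
  private
    P = G □ H
    V = Fin (size G)
    W = Fin (size H)

  inEgg : V → W → Fin (size P) → Bool
  inEgg u v x = not (u == π₁ x) ∧ (v == π₂ x)

  egg : V → W → Subset (size P)
  egg u v = tabulate (inEgg u v)

  ∈-egg : ∀ {u v a} → a ≢ u → combine a v ∈ egg u v
  ∈-egg {u} {v} {a} a≢u = Vec.lookup⇒[]= (combine a v) (egg u v) (begin
    lookup (egg u v) (combine a v)           ≡⟨ Vec.lookup∘tabulate (inEgg u v) (combine a v) ⟩
    inEgg u v (combine a v)
      ≡⟨ cong₂ (λ c d → not (u == c) ∧ (v == d)) (π₁-combine a v) (π₂-combine a v) ⟩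
    not (u == a) ∧ (v == v)
      ≡⟨ cong₂ (λ p q → not p ∧ q) (==-≢ (a≢u ∘ sym)) (==-refl v) ⟩
    true                                     ∎)
    where open ≡-Reasoning

  ∈-egg⁻ : ∀ u v {x} → x ∈ egg u v → ∃[ a ] a ≢ u × x ≡ combine a v
  ∈-egg⁻ u v {x} x∈egg with u == π₁ x in u=a | v == π₂ x in v=b
                              | trans (sym (Vec.lookup∘tabulate (inEgg u v) x)) (Vec.[]=⇒lookup x∈egg)
  ... | false | true | _ = π₁ x , ==-false⇒≢ u=a ∘ sym ,
    trans (sym (combine-π x)) (cong (combine (π₁ x)) (sym (==⇒≡ v=b)))

  lift-walk : ∀ {u v a b} → WalkIn G (∁ ⁅ u ⁆) a b → WalkIn P (egg u v) (combine a v) (combine b v)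
  lift-walk here = here
  lift-walk {u} {v} (step {a} {c} e c∈ walk) = step positive (∈-egg c≢u) (lift-walk walk)
    where
    c≢u : c ≢ u
    c≢u = ∈∁⁅⁆⇒≢ c∈
    -- `prodEdges` reads off edges of `H` when the first coordinates agree, so this case is excluded
    -- by looplessness.
    a≢c : a ≢ c
    a≢c refl = ℕ.<-irrefl refl (subst (0 <_) (loopless G a) e)
    horizontal : prodEdges G H (a , v) (c , v) ≡ edges G a c
    horizontal rewrite ==-≢ a≢c | ==-refl v = refl
    positive : 0 < edges P (combine a v) (combine c v)
    positive = subst (0 <_) (sym (trans (edges-combine a v c v) horizontal)) e

  -- Deleting the single vertex `u` leaves `G` connected because κ(G) ≥ 2, and walks of the
  -- remainder lift to the copy over `v`.
  egg-connected : ∀ u v → InducesConnected P (egg u v)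
  egg-connected u v with proj₂ κ≥2 ⁅ u ⁆ (subst (_< 2) (sym (Subset.∣⁅x⁆∣≡1 u)) (s≤s (s≤s z≤n)))
  ... | (a , a∈) , walks = (combine a v , ∈-egg (∈∁⁅⁆⇒≢ a∈)) , connect
    where
    outside : ∀ {b} → b ≢ u → b ∈ ∁ ⁅ u ⁆
    outside b≢u = Subset.x∉p⇒x∈∁p (Subset.x≢y⇒x∉⁅y⁆ b≢u)
    connect : ∀ x y → x ∈ egg u v → y ∈ egg u v → WalkIn P (egg u v) x y
    connect x y x∈ y∈ with ∈-egg⁻ u v x∈ | ∈-egg⁻ u v y∈
    ... | b , b≢u , refl | c , c≢u , refl = lift-walk (walks b c (outside b≢u) (outside c≢u))

  scramble : Scramble P
  scramble = record
    { eggs      = List.tabulate (λ x → egg (π₁ x) (π₂ x))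
    ; eggs-conn = All.tabulate⁺ (λ x → egg-connected (π₁ x) (π₂ x)) }

  -- In each copy some egg is hit at a vertex `a`; the egg with `a` removed must then be hit at a
  -- second vertex.
  hitting-set-size : ∀ X → HittingSet scramble X → 2 * size H ≤ ∣ X ∣
  hitting-set-size X hits = begin
    2 * size H                                                  ≡⟨ ℕ.*-comm 2 (size H) ⟩
    size H * 2                                                  ≡⟨ sumℕ-const (size H) 2 ⟨
    sumℕ {size H} (λ _ → 2)                                     ≤⟨ ℕ∑.∑-mono two-per-copy ⟩
    sumℕ (λ v → sumℕ (λ u → χ² u v))                            ≡⟨ ℕ∑.∑-swap (λ u v → χ² u v) ⟨
    sumℕ (λ u → sumℕ (λ v → χ² u v))                            ≡⟨ ℕ∑.∑-combine (size G) (size H) χ ⟨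
    sumℕ χ                                                      ≡⟨ card-sum X ⟨
    ∣ X ∣                                                       ∎
    where
    open ℕ.≤-Reasoning
    χ : Fin (size P) → ℕ
    χ x = if lookup X x then 1 else 0
    χ² : V → W → ℕ
    χ² u v = χ (combine u v)
    χ≡1 : ∀ {x} → x ∈ X → χ x ≡ 1
    χ≡1 x∈X = cong (if_then 1 else 0) (Vec.[]=⇒lookup x∈X)
    hit : ∀ u v → ∃[ a ] a ≢ u × combine a v ∈ X
    hit u v with subst₂ (λ c d → Nonempty (X ∩ egg c d)) (π₁-combine u v) (π₂-combine u v) (All.tabulate⁻ hits (combine u v))
    ... | x , x∈ with Subset.x∈p∩q⁻ X (egg u v) x∈
    ... | x∈X , x∈egg with ∈-egg⁻ u v x∈egg
    ... | a , a≢u , refl = a , a≢u , x∈X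
    two-per-copy : ∀ v → 2 ≤ sumℕ (λ u → χ² u v)
    two-per-copy v with avoid-two (proj₁ κ≥2) vertex vertex
      where
      vertex : V
      vertex = fromℕ< (proj₁ κ≥2)
    ... | u , _ with hit u v
    ... | a , _ , a∈X with hit a v
    ... | b , b≢a , b∈X = ℕ.≤-trans (ℕ.≤-reflexive (sym (cong₂ _+_ (χ≡1 b∈X) (χ≡1 a∈X))))
                                     (two-terms≤∑ (λ u → χ² u v) b≢a)

  module _ {l d} (λH : EdgeConn H l) (δG : MinValence G d) where

    module _ A u₀ v₀ u₁ v₁ (egg₀⊆A : egg u₀ v₀ ⊆ A) (egg₁⊆∁A : egg u₁ v₁ ⊆ ∁ A) where
      private
        α : V → W → Bool
        α u v = lookup A (combine u v)

      inside : ∀ {u} → u ≢ u₀ → α u v₀ ≡ true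
      inside u≢u₀ = Vec.[]=⇒lookup (egg₀⊆A (∈-egg u≢u₀))

      outside : ∀ {u} → u ≢ u₁ → α u v₁ ≡ false
      outside u≢u₁ = ∉⇒lookup≡false (Subset.x∈∁p⇒x∉p (egg₁⊆∁A (∈-egg u≢u₁)))

      Cut-column : V → Set
      Cut-column u = l ≤ cut H (column A u)

      Cut-row : W → Set
      Cut-row v = d ≤ cut G (row A v)

      -- The column meets both `A` and its complement, so its cut is bounded by the
      -- edge-connectivity of `H`.
      mixed-column : ∀ {u v w} → α u v ≡ true → α u w ≡ false → Cut-column u
      mixed-column {u} {v} {w} v∈ w∉ = proj₂ λH (column A u)
        (v , Vec.lookup⇒[]= v (column A u) (trans (lookup-column A u v) v∈))
        (w , lookup≡false⇒∈∁ (trans (lookup-column A u w) w∉))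

      -- All of this row except `u₀` lies in `A`, so its cut consists of the edges at `u₀`.
      row₀ : α u₀ v₀ ≡ false → Cut-row v₀
      row₀ u₀∉ = ℕ.≤-trans (proj₂ δG u₀) (val≤cut-without G (row A v₀) (trans (lookup-row A v₀ u₀) u₀∉)
        (λ u u≢u₀ → trans (lookup-row A v₀ u) (inside u≢u₀)))

      row₁ : α u₁ v₁ ≡ true → Cut-row v₁
      row₁ u₁∈ = ℕ.≤-trans (proj₂ δG u₁) (val≤cut-only G (row A v₁) (trans (lookup-row A v₁ u₁) u₁∈)
        (λ u u≢u₁ → trans (lookup-row A v₁ u) (outside u≢u₁)))

      other-column : ∀ {u} → u ≢ u₀ → u ≢ u₁ → Cut-column u
      other-column u≢u₀ u≢u₁ = mixed-column (inside u≢u₀) (outside u≢u₁)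

      -- Since `G` has a third vertex, two eggs in the same copy would intersect.
      v₀≢v₁ : v₀ ≢ v₁
      v₀≢v₁ refl with avoid-two (proj₁ κ≥2) u₀ u₁
      ... | w , w≢u₀ , w≢u₁ = true≢false (trans (sym (inside w≢u₀)) (outside w≢u₁))

      -- Column `u₀` leaves `A` at height `v₁`. It is mixed unless it also misses `A` at height
      -- `v₀`, and then row `v₀` pays.
      exceptional₀ : u₀ ≢ u₁ → Cut-column u₀ ⊎ Cut-row v₀
      exceptional₀ u₀≢u₁ with α u₀ v₀ in eq
      ... | true  = inj₁ (mixed-column eq (outside u₀≢u₁))
      ... | false = inj₂ (row₀ eq)

      exceptional₁ : u₀ ≢ u₁ → Cut-column u₁ ⊎ Cut-row v₁
      exceptional₁ u₀≢u₁ with α u₁ v₁ in eq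
      ... | true  = inj₂ (row₁ eq)
      ... | false = inj₁ (mixed-column (inside (u₀≢u₁ ∘ sym)) eq)

      -- Neither egg constrains this column. If it fails to go from inside `A` at `v₀` to outside at
      -- `v₁`, one of these two rows pays.
      exceptional-both : u₀ ≡ u₁ → Cut-column u₀ ⊎ ∃[ v ] Cut-row v
      exceptional-both refl with α u₀ v₀ in eq₀ | α u₀ v₁ in eq₁
      ... | false | _     = inj₂ (v₀ , row₀ eq₀)
      ... | true  | true  = inj₂ (v₁ , row₁ eq₁)
      ... | true  | false = inj₁ (mixed-column eq₀ eq₁)

      columns rows : ℕ
      columns = sumℕ (λ u → cut H (column A u))
      rows    = sumℕ (λ v → cut G (row A v))

      all-columns : (∀ u → Cut-column u) → size G * l ≤ columns
      all-columns cuts = subst (_≤ columns) (sumℕ-const (size G) l) (ℕ∑.∑-mono cuts)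

      one-row : ∀ {v} → Cut-row v → d ≤ rows
      one-row {v} d≤ = ℕ.≤-trans d≤ (ℕ∑.term≼∑ (λ v → cut G (row A v)) (λ _ → z≤n) v)

      module _ {k} (k≤nl : k ≤ size G * l) (k+2l≤ : k + 2 * l ≤ size G * l + 2 * d) where

        no-exception : (∀ u → Cut-column u) → k ≤ columns + rows
        no-exception cuts = ℕ.≤-trans k≤nl (ℕ.≤-trans (all-columns cuts) (ℕ.m≤m+n columns rows))

        one-exception : ∀ {w v} → (∀ u → u ≢ w → Cut-column u) → Cut-row v → k ≤ columns + rows
        one-exception {w} cuts cut-row = average-bound {l = l} {d = d} k≤nl k+2l≤
          (n*l≤∑+exception (λ u → cut H (column A u)) w cuts) (one-row cut-row)

        -- Both rows count because `v₀≢v₁` makes them distinct.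
        two-exceptions : Cut-row v₀ → Cut-row v₁ → k ≤ columns + rows
        two-exceptions cut₀ cut₁ = double-bound {l = l} {d = d} k+2l≤
          (n*l≤∑+exceptions (λ u → cut H (column A u)) u₀ u₁ (λ _ → other-column))
          (ℕ.≤-trans (ℕ.+-mono-≤ cut₀ cut₁) (two-terms≤∑ (λ v → cut G (row A v)) v₀≢v₁))

        except : ∀ {w} → (∀ {u} → u ≢ w → Cut-column u) → Cut-column w → ∀ u → Cut-column u
        except {w} cuts cut-w u with u ≟ w
        ... | yes refl = cut-w
        ... | no u≢w   = cuts u≢w

        except₁ : Cut-column u₀ → ∀ u → u ≢ u₁ → Cut-column u
        except₁ cut₀ u u≢u₁ with u ≟ u₀
        ... | yes refl = cut₀
        ... | no u≢u₀  = other-column u≢u₀ u≢u₁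

        except₀ : Cut-column u₁ → ∀ u → u ≢ u₀ → Cut-column u
        except₀ cut₁ u u≢u₀ with u ≟ u₁
        ... | yes refl = cut₁
        ... | no u≢u₁  = other-column u≢u₀ u≢u₁

        columns+rows : k ≤ columns + rows
        -- Equal removed vertices leave one column in doubt, different ones leave two.
        columns+rows with u₀ ≟ u₁
        ... | yes u₀≡u₁ with exceptional-both u₀≡u₁
        ...   | inj₁ cut₀      = no-exception (except others cut₀)
          where
          others : ∀ {u} → u ≢ u₀ → Cut-column u
          others u≢u₀ = other-column u≢u₀ (λ u≡u₁ → u≢u₀ (trans u≡u₁ (sym u₀≡u₁)))
        ...   | inj₂ (v , cut) = one-exception {u₀} {v}
                  (λ u u≢u₀ → other-column u≢u₀ (λ u≡u₁ → u≢u₀ (trans u≡u₁ (sym u₀≡u₁)))) cut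
        columns+rows | no u₀≢u₁ with exceptional₀ u₀≢u₁ | exceptional₁ u₀≢u₁
        ...   | inj₁ cut₀ | inj₁ cut₁ = no-exception (except (except₀ cut₁ _) cut₀)
        ...   | inj₁ cut₀ | inj₂ cut₁ = one-exception (except₁ cut₀) cut₁
        ...   | inj₂ cut₀ | inj₁ cut₁ = one-exception (except₀ cut₁) cut₀
        ...   | inj₂ cut₀ | inj₂ cut₁ = two-exceptions cut₀ cut₁

    -- `k` is kept general so that it can be either `2 * size H` or `size G * l`.
    order : ∀ {k} → k ≤ 2 * size H → k ≤ size G * l → k + 2 * l ≤ size G * l + 2 * d → OrderAtLeast scramble k
    order k≤2H k≤nl k+2l≤ .proj₁ X hits = ℕ.≤-trans k≤2H (hitting-set-size X hits)
    order {k} k≤2H k≤nl k+2l≤ .proj₂ A (some⊆A , some⊆∁A) with Any.tabulate⁻ some⊆A | Any.tabulate⁻ some⊆∁A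
    ... | x , egg₀⊆A | y , egg₁⊆∁A = subst (k ≤_) (sym (cut-□ A)) 
      (columns+rows A (π₁ x) (π₂ x) (π₁ y) (π₂ y) egg₀⊆A egg₁⊆∁A k≤nl k+2l≤)

-- Since every scramble order is at most every positive-rank degree, one scramble and one divisor
-- with the common value `k` are both optimal.
tight : ∀ {G k D} → Fin (size G) → (S : Scramble G) → OrderAtLeast S k → PositiveRank G D → deg {G} D ≡ + k →
  ScrambleNumber G k × Gonality G k
tight {G} {k} {D} v S order pr deg≡k =
  ((S , order) , λ S' m order' → ℤ.drop‿+≤+ (subst (+ m ℤ.≤_) deg≡k (scramble≤degree G S' v order' pr))) ,
  ((D , pr , deg≡k) , λ D' pr' → scramble≤degree G S v order pr')

theorem5p7 : (G H : Graph) → Connected G → Connected H → VertexConnAtLeast 2 G →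
    -- (i)
    (∀ (l d : ℕ) → EdgeConn H l → MinValence G d →
    Gonality G 2 →
    2 * ∣V∣ H ≤ ∣V∣ G * l →
    2 * ∣V∣ H + 2 * l ≤ ∣V∣ G * l + 2 * d →
    ScrambleNumber (G □ H) (2 * ∣V∣ H) × Gonality (G □ H) (2 * ∣V∣ H))
    ×
    -- (ii)
    (∀ (l d : ℕ) → EdgeConn H l → MinValence G d →
    Gonality H l →
    ∣V∣ G * l ≤ 2 * ∣V∣ H →
    l ≤ d →
    ScrambleNumber (G □ H) (∣V∣ G * l) × Gonality (G □ H) (∣V∣ G * l))
theorem5p7 G H ((u , _) , _) ((v , _) , _) κ≥2 = part-i , part-ii
  where
  open Product G H
  open PuncturedCopies G H κ≥2
  part-i : ∀ l d → EdgeConn H l → MinValence G d → Gonality G 2 →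
    2 * size H ≤ size G * l → 2 * size H + 2 * l ≤ size G * l + 2 * d →
    ScrambleNumber (G □ H) (2 * size H) × Gonality (G □ H) (2 * size H)
  part-i l d λH δG ((D , pr , deg≡2) , _) 2h≤ 2h+2l≤ =
    -- The pullback places a divisor of degree 2 on each of the `size H` copies of `G`.
    tight {D = D ∘ π₁} (combine u v) scramble (order λH δG ℕ.≤-refl 2h≤ 2h+2l≤) (positiveRank-π₁ {D} pr) (begin
      deg {G □ H} (D ∘ π₁)            ≡⟨ deg-π₁ D ⟩
      + size H ℤ.* deg {G} D          ≡⟨ cong (+ size H ℤ.*_) deg≡2 ⟩
      + size H ℤ.* + 2                ≡⟨ ℤ.pos-* (size H) 2 ⟨
      + (size H * 2)                  ≡⟨ cong +_ (ℕ.*-comm (size H) 2) ⟩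
      + (2 * size H)                  ∎)
    where open ≡-Reasoning
  part-ii : ∀ l d → EdgeConn H l → MinValence G d → Gonality H l →
    size G * l ≤ 2 * size H → l ≤ d →
    ScrambleNumber (G □ H) (size G * l) × Gonality (G □ H) (size G * l)
  part-ii l d λH δG ((D , pr , deg≡l) , _) gl≤ l≤d =
    tight {D = D ∘ π₂} (combine u v) scramble
      -- For `k = size G * l` the last condition of `order` reduces to `2 * l ≤ 2 * d`.
      (order λH δG gl≤ ℕ.≤-refl (ℕ.+-monoʳ-≤ (size G * l) (ℕ.*-monoʳ-≤ 2 l≤d))) (positiveRank-π₂ {D} pr) (begin
      deg {G □ H} (D ∘ π₂)            ≡⟨ deg-π₂ D ⟩
      + size G ℤ.* deg {H} D          ≡⟨ cong (+ size G ℤ.*_) deg≡l ⟩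
      + size G ℤ.* + l                ≡⟨ ℤ.pos-* (size G) l ⟨
      + (size G * l)                  ∎)
    where open ≡-Reasoning
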